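{- For every prime $p>2$, $$\sum_{n=0}^{p-1}\frac{(\frac12)_n^3(\frac12)_{2n}}{n!^5}(120n^2+34n+3)\frac1{2^{6n}}\equiv3p^2\pmod{p^5};$$ equivalently (using $(\frac12)_{2n}=4^n(\frac14)_n(\frac34)_n$), $$\sum_{n=0}^{p-1}\frac{(\frac12)_n^3(\frac14)_n(\frac34)_n}{n!^5}(120n^2+34n+3)\frac1{2^{4n}}\equiv3p^2\pmod{p^5}.$$
   Context: $(a)_n=a(a+1)\cdots(a+n-1)=\Gamma(a+n)/\Gamma(a)$ denotes the Pochhammer symbol, with $(a)_0=1$. The sums are rational numbers with denominators coprime to $p$; congruences are understood in the ring of rationals with denominators coprime to $p$. -}

module Defs where

open import Data.Nat as ℕ using (ℕ; zero; suc; _!)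
open import Data.Nat.Divisibility using (_∣_)
open import Data.Nat.Properties using (m*n≢0; _!≢0)
open import Data.Nat.Properties using (m^n≢0)
open import Data.Nat.Combinatorics using ()
open import Data.Integer as ℤ using (ℤ; +_)
open import Data.Rational as ℚ using (ℚ; _+_; _*_; _-_; 1ℚ; 0ℚ; ½)
open import Data.Product using (Σ; _×_)
open import Relation.Nullary using (¬_)
open import Relation.Binary.PropositionalEquality using (_≡_)

ℕ→ℚ : ℕ → ℚ
ℕ→ℚ n = (+ n) ℚ./ 1

poch : ℚ → ℕ → ℚ
poch a zero    = 1ℚ
poch a (suc n) = poch a n * (a + ℕ→ℚ n)

invDen : ℕ → ℚ
invDen n = ℚ._/_ (+ 1) ((n !) ℕ.^ 5 ℕ.* 2 ℕ.^ (6 ℕ.* n))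
  {{m*n≢0 ((n !) ℕ.^ 5) (2 ℕ.^ (6 ℕ.* n)) {{m^n≢0 (n !) 5 {{n !≢0}}}} {{m^n≢0 2 (6 ℕ.* n)}}}}

term : ℕ → ℚ
term n = poch ½ n * poch ½ n * poch ½ n * poch ½ (2 ℕ.* n)
         * ℕ→ℚ (120 ℕ.* n ℕ.* n ℕ.+ 34 ℕ.* n ℕ.+ 3) * invDen n

sumTo : ℕ → (ℕ → ℚ) → ℚ
sumTo zero    f = 0ℚ
sumTo (suc N) f = sumTo N f + f N

-- x ≡ y (mod m) in the ring of rationals with denominators coprime to p,
-- for modulus m = p^k: x - y = m * q with q a rational whose (reduced)
-- denominator is not divisible by p.
CongModPow : ℕ → ℕ → ℚ → ℚ → Set
CongModPow p k x y =
  Σ ℚ (λ q → (¬ (p ∣ ℚ.denominatorℕ q)) × (x - y ≡ ℕ→ℚ (p ℕ.^ k) * q))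

{-# OPTIONS --safe #-}
module Submission where

-- Write p = 2m + 1. Guillera's WZ pair moves the sum, up to boundary terms divisible by p⁵, from the
-- parameter k = 0 to k = −m. There the summand vanishes for n < m and is divisible by p⁵ for
-- m < n < p, so that only the term n = m survives. It is 3p² times a ratio of products
-- R(a) = ∏ (i + ap/2) over 1 ≤ i ≤ m and of powers of 4ᵐ. The reflection and duplication formulas give
--   R(2a) R(−2 − 2a) = 4ᵐ R(−1 − a) R(a),
-- which for a = 0 eliminates 4ᵐ, and for a = 1 then yields R(2) R(−4) R(−1) = R(−2)² R(1).
-- Expanding modulo p³, this relation says exactly that three times the ratio is 3; it plays the part of
-- the congruence 3 (1 + 1/2² + ⋯ + 1/m²) ≡ 0 (mod p), and it includes the case p = 3.

open import Defs
open import Data.Nat using (ℕ; _>_)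
open import Data.Nat.Primality using (Prime)

open import Algebra.Bundles using (CommutativeRing)
import Algebra.Solver.Ring
open import Algebra.Solver.Ring.AlmostCommutativeRing
  using (fromCommutativeRing; _-Raw-AlmostCommutative⟶_)
open import Data.Empty using (⊥-elim)
import Data.Integer as ℤ
open import Data.Integer using (ℤ; +_)
open import Data.Integer.GCD using (gcd)
import Data.Integer.Properties as ℤₚ
import Data.Maybe as Maybe
import Data.Nat as ℕ
open import Data.Nat using (zero; suc; _!)
open import Data.Nat.Divisibility as ℕ∣ using (_∣_; ∣⇒≤)
open import Data.Nat.DivMod using (m≡m%n+[m/n]*n; m%n<n)
open import Data.Nat.Primality using (euclidsLemma; prime⇒irreducible; prime⇒nonTrivial)
import Data.Nat.Properties as ℕₚ
open import Data.Nat.Properties using (m*n≢0; m^n≢0; _!≢0)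
import Data.Nat.Solver
open import Data.Product using (Σ; _×_; _,_)
import Data.Rational as ℚ
open import Data.Rational using (ℚ; _+_; _*_; _-_; -_; 0ℚ; 1ℚ; ½)
import Data.Rational.Properties as ℚₚ
import Data.Rational.Unnormalised as ℚᵘ
import Data.Rational.Unnormalised.Properties as ℚᵘₚ
open import Data.Sum using (_⊎_; inj₁; inj₂)
open import Relation.Binary.PropositionalEquality
open import Relation.Nullary using (¬_)
open import Relation.Nullary.Decidable using (dec⇒maybe)
open ≡-Reasoning

module ℕₛ = Data.Nat.Solver.+-*-Solver

-- Rational arithmetic

ℤ→ℚ : ℤ → ℚ
ℤ→ℚ i = i ℚ./ 1

-- Unnormalised rationals involve no gcd, so the homomorphism laws of `ℤ→ℚ` are checked there and
-- carried back by injectivity of `ℚ.toℚᵘ`.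
toℚᵘ-ℤ→ℚ : ∀ i → ℚ.toℚᵘ (ℤ→ℚ i) ℚᵘ.≃ ℚᵘ.mkℚᵘ i 0
toℚᵘ-ℤ→ℚ i = ℚₚ.toℚᵘ-fromℚᵘ (ℚᵘ.mkℚᵘ i 0)

ℤ→ℚ-+ : ∀ i j → ℤ→ℚ (i ℤ.+ j) ≡ ℤ→ℚ i + ℤ→ℚ j
ℤ→ℚ-+ i j = ℚₚ.toℚᵘ-injective (ℚᵘₚ.≃-trans (toℚᵘ-ℤ→ℚ (i ℤ.+ j)) (ℚᵘₚ.≃-trans
  (ℚᵘ.*≡* (cong (ℤ._* + 1) (cong₂ ℤ._+_ (sym (ℤₚ.*-identityʳ i)) (sym (ℤₚ.*-identityʳ j)))))
  (ℚᵘₚ.≃-sym (ℚᵘₚ.≃-trans (ℚₚ.toℚᵘ-homo-+ (ℤ→ℚ i) (ℤ→ℚ j))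
    (ℚᵘₚ.+-cong (toℚᵘ-ℤ→ℚ i) (toℚᵘ-ℤ→ℚ j))))))

ℤ→ℚ-* : ∀ i j → ℤ→ℚ (i ℤ.* j) ≡ ℤ→ℚ i * ℤ→ℚ j
ℤ→ℚ-* i j = ℚₚ.toℚᵘ-injective (ℚᵘₚ.≃-trans (toℚᵘ-ℤ→ℚ (i ℤ.* j))
  (ℚᵘₚ.≃-sym (ℚᵘₚ.≃-trans (ℚₚ.toℚᵘ-homo-* (ℤ→ℚ i) (ℤ→ℚ j))
    (ℚᵘₚ.*-cong (toℚᵘ-ℤ→ℚ i) (toℚᵘ-ℤ→ℚ j)))))

ℤ→ℚ-neg : ∀ i → ℤ→ℚ (ℤ.- i) ≡ - ℤ→ℚ i
ℤ→ℚ-neg i = ℚₚ.toℚᵘ-injective (ℚᵘₚ.≃-trans (toℚᵘ-ℤ→ℚ (ℤ.- i))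
  (ℚᵘₚ.≃-sym (ℚᵘₚ.≃-trans (ℚₚ.toℚᵘ-homo‿- (ℤ→ℚ i)) (ℚᵘₚ.-‿cong (toℚᵘ-ℤ→ℚ i)))))

ℤ⟶ℚ : CommutativeRing.rawRing ℤₚ.+-*-commutativeRing
      -Raw-AlmostCommutative⟶ fromCommutativeRing ℚₚ.+-*-commutativeRing
ℤ⟶ℚ = record
  { ⟦_⟧    = ℤ→ℚ
  ; +-homo = ℤ→ℚ-+
  ; *-homo = ℤ→ℚ-*
  ; -‿homo = ℤ→ℚ-neg
  ; 0-homo = refl
  ; 1-homo = refl
  }

module RS = Algebra.Solver.Ring
  (CommutativeRing.rawRing ℤₚ.+-*-commutativeRing)
  (fromCommutativeRing ℚₚ.+-*-commutativeRing)
  ℤ⟶ℚ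
  (λ i j → Maybe.map (cong ℤ→ℚ) (dec⇒maybe (i ℤ.≟ j)))
open RS using (solve; _:+_; _:*_; _:-_; :-_; _:=_; con)

ℕ→ℚ-+ : ∀ m n → ℕ→ℚ (m ℕ.+ n) ≡ ℕ→ℚ m + ℕ→ℚ n
ℕ→ℚ-+ m n = ℤ→ℚ-+ (+ m) (+ n)

ℕ→ℚ-* : ∀ m n → ℕ→ℚ (m ℕ.* n) ≡ ℕ→ℚ m * ℕ→ℚ n
ℕ→ℚ-* m n = trans (cong ℤ→ℚ (ℤₚ.pos-* m n)) (ℤ→ℚ-* (+ m) (+ n))

ℕ→ℚ-suc : ∀ n → ℕ→ℚ (suc n) ≡ 1ℚ + ℕ→ℚ n
ℕ→ℚ-suc n = ℕ→ℚ-+ 1 n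

recip : ∀ n → .{{ℕ.NonZero n}} → ℚ
recip n = + 1 ℚ./ n

*-recip : ∀ n .{{_ : ℕ.NonZero n}} → ℕ→ℚ n * recip n ≡ 1ℚ
*-recip n@(suc n-1) = ℚₚ.toℚᵘ-injective (ℚᵘₚ.≃-trans (ℚₚ.toℚᵘ-homo-* (ℕ→ℚ n) (recip n))
  (ℚᵘₚ.≃-trans (ℚᵘₚ.*-cong (toℚᵘ-ℤ→ℚ (+ n)) (ℚₚ.toℚᵘ-fromℚᵘ (ℚᵘ.mkℚᵘ (+ 1) n-1)))
    (ℚᵘ.*≡* (trans (ℤₚ.*-identityʳ _) (trans (ℤₚ.*-comm (+ n) (+ 1)) (cong (+ 1 ℤ.*_) (cong +_ (sym (ℕₚ.+-identityʳ n)))))))))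

-- Reduction to lowest terms only divides n by a gcd. Hence coprimality to p can be read off any
-- unreduced denominator.
↧-/-∣ : ∀ i n .{{_ : ℕ.NonZero n}} → ℚ.denominatorℕ (i ℚ./ n) ∣ n
↧-/-∣ i n = ℕ∣.divides ℤ.∣ g ∣ (sym (trans (ℕₚ.*-comm ℤ.∣ g ∣ _)
  (trans (sym (ℤₚ.abs-* (ℚ.↧ (i ℚ./ n)) g)) (cong ℤ.∣_∣ (ℚₚ.↧-/ i n)))))
  where g = gcd i (+ n)

↧-+-∣ : ∀ x y → ℚ.denominatorℕ (x + y) ∣ ℚ.denominatorℕ x ℕ.* ℚ.denominatorℕ y
↧-+-∣ x@record{} y@record{} =
  ↧-/-∣ (ℚ.↥ x ℤ.* ℚ.↧ y ℤ.+ ℚ.↥ y ℤ.* ℚ.↧ x) (ℚ.↧ₙ x ℕ.* ℚ.↧ₙ y)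

↧-*-∣ : ∀ x y → ℚ.denominatorℕ (x * y) ∣ ℚ.denominatorℕ x ℕ.* ℚ.denominatorℕ y
↧-*-∣ x@record{} y@record{} = ↧-/-∣ (ℚ.↥ x ℤ.* ℚ.↥ y) (ℚ.↧ₙ x ℕ.* ℚ.↧ₙ y)

-- Divisibility by powers of p among p-integral rationals

module Local (p : ℕ) (pr : Prime p) where

  p∤1 : ¬ (p ∣ 1)
  p∤1 p∣1 = ℕₚ.<⇒≱ (ℕ.nonTrivial⇒n>1 p {{prime⇒nonTrivial pr}}) (∣⇒≤ p∣1)

  p∤-* : ∀ {a b} → ¬ (p ∣ a) → ¬ (p ∣ b) → ¬ (p ∣ a ℕ.* b)
  p∤-* {a} {b} p∤a p∤b p∣ab with euclidsLemma a b pr p∣ab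
  ... | inj₁ p∣a = p∤a p∣a
  ... | inj₂ p∣b = p∤b p∣b

  -- The fields are those of `CongModPow p k`, with x in place of the difference. As a record, it
  -- lets k and x be inferred from a proof.
  record Divides (k : ℕ) (x : ℚ) : Set where
    constructor divides
    field
      quotient          : ℚ
      quotient-integral : ¬ (p ∣ ℚ.denominatorℕ quotient)
      factorisation     : x ≡ ℕ→ℚ (p ℕ.^ k) * quotient

  Integral : ℚ → Set
  Integral = Divides 0

  /-integral : ∀ i n .{{_ : ℕ.NonZero n}} → ¬ (p ∣ n) → Integral (i ℚ./ n)
  /-integral i n p∤n = divides (i ℚ./ n) (λ p∣d → p∤n (ℕ∣.∣-trans p∣d (↧-/-∣ i n))) (sym (ℚₚ.*-identityˡ _))

  ℕ-integral : ∀ n → Integral (ℕ→ℚ n)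
  ℕ-integral n = /-integral (+ n) 1 p∤1

  div-+ : ∀ {k x y} → Divides k x → Divides k y → Divides k (x + y)
  div-+ {k} (divides q dq refl) (divides r dr refl) = divides (q + r)
    (λ h → p∤-* dq dr (ℕ∣.∣-trans h (↧-+-∣ q r))) (sym (ℚₚ.*-distribˡ-+ (ℕ→ℚ (p ℕ.^ k)) q r))

  div-* : ∀ {k l x y} → Divides k x → Divides l y → Divides (k ℕ.+ l) (x * y)
  div-* {k} {l} (divides q dq refl) (divides r dr refl) = divides (q * r)
    (λ h → p∤-* dq dr (ℕ∣.∣-trans h (↧-*-∣ q r)))
    (trans (solve 4 (λ a q b r → (a :* q) :* (b :* r) := (a :* b) :* (q :* r)) refl (ℕ→ℚ (p ℕ.^ k)) q (ℕ→ℚ (p ℕ.^ l)) r)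
      (cong (_* (q * r)) (sym (trans (cong ℕ→ℚ (ℕₚ.^-distribˡ-+-* p k l)) (ℕ→ℚ-* (p ℕ.^ k) (p ℕ.^ l))))))

  div-neg : ∀ {k x} → Divides k x → Divides k (- x)
  div-neg {k} {x} dx = subst (Divides k) (solve 1 (λ x → con (ℤ.- (+ 1)) :* x := :- x) refl x) (div-* (/-integral (ℤ.- (+ 1)) 1 p∤1) dx)

  div-- : ∀ {k x y} → Divides k x → Divides k y → Divides k (x - y)
  div-- dx dy = div-+ dx (div-neg dy)

  div-0 : ∀ k → Divides k 0ℚ
  div-0 k = divides 0ℚ p∤1 (sym (ℚₚ.*-zeroʳ (ℕ→ℚ (p ℕ.^ k))))

  div-p : Divides 1 (ℕ→ℚ p)
  div-p = divides 1ℚ p∤1 (sym (trans (ℚₚ.*-identityʳ _) (cong ℕ→ℚ (ℕₚ.*-identityʳ p))))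

  div-weaken : ∀ k {l x} → Divides (k ℕ.+ l) x → Divides l x
  div-weaken k {l} (divides q dq refl) = subst (Divides l)
    (trans (solve 3 (λ a b q → a :* (b :* q) := (a :* b) :* q) refl (ℕ→ℚ (p ℕ.^ k)) (ℕ→ℚ (p ℕ.^ l)) q)
      (cong (_* q) (sym (trans (cong ℕ→ℚ (ℕₚ.^-distribˡ-+-* p k l)) (ℕ→ℚ-* (p ℕ.^ k) (p ℕ.^ l))))))
    (div-* (ℕ-integral (p ℕ.^ k)) (divides q dq refl))

  div-cancel : ∀ {k x} n .{{_ : ℕ.NonZero n}} → ¬ (p ∣ n) → Divides k (ℕ→ℚ n * x) → Divides k x
  div-cancel {k} {x} n p∤n d = subst (Divides k)
    (trans (solve 3 (λ a r x → r :* (a :* x) := (a :* r) :* x) refl (ℕ→ℚ n) (recip n) x)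
      (trans (cong (_* x) (*-recip n)) (ℚₚ.*-identityˡ x)))
    (div-* (/-integral (+ 1) n p∤n) d)

-- Pochhammer symbols and denominators

signed : ℕ → ℚ
signed zero    = 1ℚ
signed (suc m) = - signed m

signed² : ∀ m → signed m * signed m ≡ 1ℚ
signed² zero    = refl
signed² (suc m) = trans (solve 1 (λ s → (:- s) :* (:- s) := s :* s) refl (signed m)) (signed² m)

poch-+ : ∀ a m k → poch a (m ℕ.+ k) ≡ poch a m * poch (a + ℕ→ℚ m) k
poch-+ a m zero    = trans (cong (poch a) (ℕₚ.+-identityʳ m)) (sym (ℚₚ.*-identityʳ _))
poch-+ a m (suc k) = begin
  poch a (m ℕ.+ suc k)                                          ≡⟨ cong (poch a) (ℕₚ.+-suc m k) ⟩
  poch a (m ℕ.+ k) * (a + ℕ→ℚ (m ℕ.+ k))                        ≡⟨ cong₂ (λ x y → x * (a + y)) (poch-+ a m k) (ℕ→ℚ-+ m k) ⟩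
  poch a m * poch (a + ℕ→ℚ m) k * (a + (ℕ→ℚ m + ℕ→ℚ k))         ≡⟨ solve 5 (λ x y a m k → x :* y :* (a :+ (m :+ k)) := x :* (y :* (a :+ m :+ k))) refl (poch a m) (poch (a + ℕ→ℚ m) k) a (ℕ→ℚ m) (ℕ→ℚ k) ⟩
  poch a m * (poch (a + ℕ→ℚ m) k * (a + ℕ→ℚ m + ℕ→ℚ k))         ∎

poch-suc : ∀ a m → poch a (suc m) ≡ a * poch (a + 1ℚ) m
poch-suc a m = trans (poch-+ a 1 m)
  (cong (_* poch (a + 1ℚ) m) (solve 1 (λ a → con (+ 1) :* (a :+ con (+ 0)) := a) refl a))

-- Reversing the order of the m factors and negating each of them turns the progression starting at
-- a into the one starting at 1 - a - m. The first factor of one side is the last of the other,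
-- whence `poch-suc`.
poch-reflect : ∀ a m → poch a m ≡ signed m * poch (1ℚ - a - ℕ→ℚ m) m
poch-reflect a zero    = refl
poch-reflect a (suc m) = begin
  poch a (suc m)
    ≡⟨ poch-suc a m ⟩
  a * poch (a + 1ℚ) m
    ≡⟨ cong (a *_) (poch-reflect (a + 1ℚ) m) ⟩
  a * (signed m * poch (1ℚ - (a + 1ℚ) - ℕ→ℚ m) m)
    ≡⟨ cong (λ x → a * (signed m * poch x m)) base ⟩
  a * (signed m * poch b m)
    ≡⟨ solve 4 (λ a s x m → a :* (s :* x) := (:- s) :* (x :* (con (+ 1) :- a :- (con (+ 1) :+ m) :+ m))) refl a (signed m) (poch b m) (ℕ→ℚ m) ⟩
  - signed m * (poch b m * (1ℚ - a - (1ℚ + ℕ→ℚ m) + ℕ→ℚ m))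
    ≡⟨ cong (λ x → - signed m * (poch b m * (1ℚ - a - x + ℕ→ℚ m))) (ℕ→ℚ-suc m) ⟨
  - signed m * poch b (suc m) ∎
  where
  b = 1ℚ - a - ℕ→ℚ (suc m)
  base : 1ℚ - (a + 1ℚ) - ℕ→ℚ m ≡ b
  base = trans (solve 2 (λ a m → con (+ 1) :- (a :+ con (+ 1)) :- m := con (+ 1) :- a :- (con (+ 1) :+ m)) refl a (ℕ→ℚ m))
    (cong (λ x → 1ℚ - a - x) (sym (ℕ→ℚ-suc m)))

-- The factors of index 2i and 2i + 1 on the left are 2(a + i) and 2(a + ½ + i).
poch-duplication : ∀ a m → poch (a + a) (m ℕ.+ m) ≡ ℕ→ℚ (4 ℕ.^ m) * (poch a m * poch (a + ½) m)
poch-duplication a zero    = refl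
poch-duplication a (suc m) = begin
  poch (a + a) (suc m ℕ.+ suc m)
    ≡⟨ cong (λ k → poch (a + a) (suc k)) (ℕₚ.+-suc m m) ⟩
  poch (a + a) (m ℕ.+ m) * (a + a + ℕ→ℚ (m ℕ.+ m)) * (a + a + ℕ→ℚ (suc (m ℕ.+ m)))
    ≡⟨ cong₂ (λ x y → x * (a + a + ℕ→ℚ (m ℕ.+ m)) * (a + a + y)) (poch-duplication a m) (ℕ→ℚ-suc (m ℕ.+ m)) ⟩
  ℕ→ℚ (4 ℕ.^ m) * (poch a m * poch (a + ½) m) * (a + a + ℕ→ℚ (m ℕ.+ m)) * (a + a + (1ℚ + ℕ→ℚ (m ℕ.+ m)))
    ≡⟨ cong (λ x → ℕ→ℚ (4 ℕ.^ m) * (poch a m * poch (a + ½) m) * (a + a + x) * (a + a + (1ℚ + x))) (ℕ→ℚ-+ m m) ⟩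
  ℕ→ℚ (4 ℕ.^ m) * (poch a m * poch (a + ½) m) * (a + a + (ℕ→ℚ m + ℕ→ℚ m)) * (a + a + (1ℚ + (ℕ→ℚ m + ℕ→ℚ m)))
    -- The solver has integer coefficients, so ½ is a variable h, and 1 is entered as h + h, which
    -- computes to `1ℚ` at h = ½.
    ≡⟨ solve 6 (λ c x y a m h → c :* (x :* y) :* (a :+ a :+ (m :+ m)) :* (a :+ a :+ ((h :+ h) :+ (m :+ m)))
                := con (+ 4) :* c :* (x :* (a :+ m) :* (y :* (a :+ h :+ m)))) refl
         (ℕ→ℚ (4 ℕ.^ m)) (poch a m) (poch (a + ½) m) a (ℕ→ℚ m) ½ ⟩
  ℕ→ℚ 4 * ℕ→ℚ (4 ℕ.^ m) * (poch a (suc m) * poch (a + ½) (suc m))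
    ≡⟨ cong (_* (poch a (suc m) * poch (a + ½) (suc m))) (ℕ→ℚ-* 4 (4 ℕ.^ m)) ⟨
  ℕ→ℚ (4 ℕ.^ suc m) * (poch a (suc m) * poch (a + ½) (suc m)) ∎

falling : ℚ → ℕ → ℚ
falling x zero    = 1ℚ
falling x (suc j) = falling x j * (x - ℕ→ℚ j)

-- The first factor is split off here, where the definition splits off the last.
falling-suc : ∀ x j → falling (1ℚ + x) (suc j) ≡ (1ℚ + x) * falling x j
falling-suc x zero    = solve 1 (λ x → con (+ 1) :* (con (+ 1) :+ x :- con (+ 0)) := (con (+ 1) :+ x) :* con (+ 1)) refl x
falling-suc x (suc j) = begin
  falling (1ℚ + x) (suc j) * (1ℚ + x - ℕ→ℚ (suc j))
    ≡⟨ cong₂ (λ u v → u * (1ℚ + x - v)) (falling-suc x j) (ℕ→ℚ-suc j) ⟩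
  (1ℚ + x) * falling x j * (1ℚ + x - (1ℚ + ℕ→ℚ j))
    ≡⟨ solve 3 (λ x f j → (con (+ 1) :+ x) :* f :* (con (+ 1) :+ x :- (con (+ 1) :+ j)) := (con (+ 1) :+ x) :* (f :* (x :- j))) refl x (falling x j) (ℕ→ℚ j) ⟩
  (1ℚ + x) * (falling x j * (x - ℕ→ℚ j)) ∎

-- The product contains the factor n - n. This is what makes the shifted summand vanish below n = m.
falling-< : ∀ {n j} → n ℕ.< j → falling (ℕ→ℚ n) j ≡ 0ℚ
falling-< {n} {suc j} n<1+j with ℕₚ.m<1+n⇒m<n∨m≡n n<1+j
... | inj₁ n<j  = trans (cong (_* (ℕ→ℚ n - ℕ→ℚ j)) (falling-< n<j)) (ℚₚ.*-zeroˡ (ℕ→ℚ n - ℕ→ℚ j))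
... | inj₂ refl = solve 2 (λ f n → f :* (n :- n) := con (+ 0)) refl (falling (ℕ→ℚ n) n) (ℕ→ℚ n)

falling-! : ∀ n → falling (ℕ→ℚ n) n ≡ ℕ→ℚ (n !)
falling-! zero    = refl
falling-! (suc n) = begin
  falling (ℕ→ℚ (suc n)) (suc n)   ≡⟨ cong (λ x → falling x (suc n)) (ℕ→ℚ-suc n) ⟩
  falling (1ℚ + ℕ→ℚ n) (suc n)    ≡⟨ falling-suc (ℕ→ℚ n) n ⟩
  (1ℚ + ℕ→ℚ n) * falling (ℕ→ℚ n) n ≡⟨ cong₂ _*_ (sym (ℕ→ℚ-suc n)) (falling-! n) ⟩
  ℕ→ℚ (suc n) * ℕ→ℚ (n !)         ≡⟨ ℕ→ℚ-* (suc n) (n !) ⟨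
  ℕ→ℚ (suc n !)                   ∎

poch-! : ∀ n → poch 1ℚ n ≡ ℕ→ℚ (n !)
poch-! zero    = refl
poch-! (suc n) = begin
  poch 1ℚ n * (1ℚ + ℕ→ℚ n)   ≡⟨ cong₂ _*_ (poch-! n) (sym (ℕ→ℚ-suc n)) ⟩
  ℕ→ℚ (n !) * ℕ→ℚ (suc n)    ≡⟨ ℚₚ.*-comm (ℕ→ℚ (n !)) (ℕ→ℚ (suc n)) ⟩
  ℕ→ℚ (suc n) * ℕ→ℚ (n !)    ≡⟨ ℕ→ℚ-* (suc n) (n !) ⟨
  ℕ→ℚ (suc n !)              ∎

infix 8 _⁵
_⁵ : ℚ → ℚ
x ⁵ = x * x * x * x * x

ℕ→ℚ-^5 : ∀ n → ℕ→ℚ (n ℕ.^ 5) ≡ ℕ→ℚ n ⁵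
ℕ→ℚ-^5 n = begin
  ℕ→ℚ (n ℕ.^ 5)
    ≡⟨ cong ℕ→ℚ (ℕₛ.solve 1 (λ n → n ℕₛ.:^ 5 ℕₛ.:= n ℕₛ.:* n ℕₛ.:* n ℕₛ.:* n ℕₛ.:* n) refl n) ⟩
  ℕ→ℚ (n ℕ.* n ℕ.* n ℕ.* n ℕ.* n)
    ≡⟨ ℕ→ℚ-* (n ℕ.* n ℕ.* n ℕ.* n) n ⟩
  ℕ→ℚ (n ℕ.* n ℕ.* n ℕ.* n) * ℕ→ℚ n
    ≡⟨ cong (_* ℕ→ℚ n) (ℕ→ℚ-* (n ℕ.* n ℕ.* n) n) ⟩
  ℕ→ℚ (n ℕ.* n ℕ.* n) * ℕ→ℚ n * ℕ→ℚ n
    ≡⟨ cong (λ x → x * ℕ→ℚ n * ℕ→ℚ n) (ℕ→ℚ-* (n ℕ.* n) n) ⟩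
  ℕ→ℚ (n ℕ.* n) * ℕ→ℚ n * ℕ→ℚ n * ℕ→ℚ n
    ≡⟨ cong (λ x → x * ℕ→ℚ n * ℕ→ℚ n * ℕ→ℚ n) (ℕ→ℚ-* n n) ⟩
  ℕ→ℚ n ⁵ ∎

64^n : ∀ n → 2 ℕ.^ (6 ℕ.* n) ≡ 64 ℕ.^ n
64^n n = sym (ℕₚ.^-*-assoc 2 6 n)

den : ℕ → ℕ
den n = (n !) ℕ.^ 5 ℕ.* 2 ℕ.^ (6 ℕ.* n)

den-* : ∀ n → ℕ→ℚ (den n) ≡ ℕ→ℚ (n !) ⁵ * ℕ→ℚ (64 ℕ.^ n)
den-* n = trans (ℕ→ℚ-* ((n !) ℕ.^ 5) _) (cong₂ _*_ (ℕ→ℚ-^5 (n !)) (cong ℕ→ℚ (64^n n)))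

den-invDen : ∀ n → ℕ→ℚ (n !) ⁵ * ℕ→ℚ (64 ℕ.^ n) * invDen n ≡ 1ℚ
den-invDen n = trans (cong (_* invDen n) (sym (den-* n))) (*-recip (den n) {{den≢0}})
  where den≢0 = m*n≢0 ((n !) ℕ.^ 5) (2 ℕ.^ (6 ℕ.* n)) {{m^n≢0 (n !) 5 {{n !≢0}}}} {{m^n≢0 2 (6 ℕ.* n)}}

invDen-suc : ∀ n → invDen n ≡ ℕ→ℚ 64 * ℕ→ℚ (suc n) ⁵ * invDen (suc n)
invDen-suc n = begin
  invDen n
    ≡⟨ ℚₚ.*-identityʳ (invDen n) ⟨
  invDen n * 1ℚ
    ≡⟨ cong (invDen n *_) (den-invDen (suc n)) ⟨
  invDen n * (ℕ→ℚ (suc n !) ⁵ * ℕ→ℚ (64 ℕ.^ suc n) * i)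
    ≡⟨ cong₂ (λ x y → invDen n * (x ⁵ * y * i)) (ℕ→ℚ-* (suc n) (n !)) (ℕ→ℚ-* 64 (64 ℕ.^ n)) ⟩
  invDen n * ((ℕ→ℚ (suc n) * ℕ→ℚ (n !)) ⁵ * (ℕ→ℚ 64 * ℕ→ℚ (64 ℕ.^ n)) * i)
    ≡⟨ solve 5 (λ d s f q i → let five = λ x → x :* x :* x :* x :* x in
         d :* (five (s :* f) :* (con (+ 64) :* q) :* i) := (five f :* q :* d) :* (con (+ 64) :* five s :* i))
         refl (invDen n) (ℕ→ℚ (suc n)) (ℕ→ℚ (n !)) (ℕ→ℚ (64 ℕ.^ n)) i ⟩
  (ℕ→ℚ (n !) ⁵ * ℕ→ℚ (64 ℕ.^ n) * invDen n) * (ℕ→ℚ 64 * ℕ→ℚ (suc n) ⁵ * i)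
    ≡⟨ cong (_* (ℕ→ℚ 64 * ℕ→ℚ (suc n) ⁵ * i)) (den-invDen n) ⟩
  1ℚ * (ℕ→ℚ 64 * ℕ→ℚ (suc n) ⁵ * i)
    ≡⟨ ℚₚ.*-identityˡ _ ⟩
  ℕ→ℚ 64 * ℕ→ℚ (suc n) ⁵ * i ∎
  where i = invDen (suc n)

-- The WZ pair

infix 8 _²
_² _³ : ℚ → ℚ
x ² = x * x
x ³ = x * x * x

-- 120 n² − 84 j n + 34 n − 10 j + 3, made homogeneous by w = ½: the WZ identity then has integer
-- coefficients.
linear : ℚ → ℚ → ℚ → ℚ
linear w n j = ℕ→ℚ 120 * n * n - ℕ→ℚ 84 * j * n + ℕ→ℚ 68 * w * n - ℕ→ℚ 20 * w * j + ℕ→ℚ 12 * w * w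

-- G and F form Guillera's WZ pair at k = −j, multiplied by (½)ⱼ³ to avoid dividing by it. The square of
-- falling n j = n!/(n − j)! turns the n!⁵ of invDen into n!³ (n − j)!².
weight : ℕ → ℕ → ℚ
weight n j = poch ½ n ³ * poch ½ (2 ℕ.* n ℕ.+ j) * falling (ℕ→ℚ n) j ² * invDen n

G : ℕ → ℕ → ℚ
G j n = weight n j * linear ½ (ℕ→ℚ n) (ℕ→ℚ j)

F : ℕ → ℕ → ℚ
F j zero    = 0ℚ
F j (suc n) = ℕ→ℚ 4 * poch ½ (suc n) ³ * poch ½ (2 ℕ.* suc n ℕ.+ j) * falling (ℕ→ℚ n) j ² * invDen n

-- Passing from `invDen n` to `invDen (suc n)` yields 64 (n + 1)⁵. Two of these five factors are
-- absorbed by the square of `falling`, since n + 1 times `falling n j` is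
-- `falling (n + 1) (j + 1)`; the other three stay as a cube.
F-weight : ∀ j n → F j n ≡ weight n j * (ℕ→ℚ 256 * ℕ→ℚ n ³ * (ℕ→ℚ n - ℕ→ℚ j) ²)
F-weight j zero    = solve 2 (λ w j → con (+ 0) := w :* (con (+ 256) :* con (+ 0) :* ((con (+ 0) :- j) :* (con (+ 0) :- j)))) refl (weight 0 j) (ℕ→ℚ j)
F-weight j (suc n) = begin
  ℕ→ℚ 4 * a * b * falling (ℕ→ℚ n) j ² * invDen n
    ≡⟨ cong (ℕ→ℚ 4 * a * b * falling (ℕ→ℚ n) j ² *_) (invDen-suc n) ⟩
  ℕ→ℚ 4 * a * b * falling (ℕ→ℚ n) j ² * (ℕ→ℚ 64 * s ⁵ * invDen (suc n))
    ≡⟨ solve 5 (λ a b f s i → con (+ 4) :* a :* b :* (f :* f) :* (con (+ 64) :* (s :* s :* s :* s :* s) :* i)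
         := con (+ 256) :* a :* b :* (s :* s :* s) :* ((s :* f) :* (s :* f)) :* i) refl a b (falling (ℕ→ℚ n) j) s (invDen (suc n)) ⟩
  ℕ→ℚ 256 * a * b * s ³ * (s * falling (ℕ→ℚ n) j) ² * invDen (suc n)
    ≡⟨ cong (λ x → ℕ→ℚ 256 * a * b * s ³ * x ² * invDen (suc n)) shift ⟩
  ℕ→ℚ 256 * a * b * s ³ * (falling s j * (s - ℕ→ℚ j)) ² * invDen (suc n)
    ≡⟨ solve 6 (λ a b f s i j → con (+ 256) :* a :* b :* (s :* s :* s) :* ((f :* (s :- j)) :* (f :* (s :- j))) :* i
         := (a :* b :* (f :* f) :* i) :* (con (+ 256) :* (s :* s :* s) :* ((s :- j) :* (s :- j)))) refl
         a b (falling s j) s (invDen (suc n)) (ℕ→ℚ j) ⟩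
  weight (suc n) j * (ℕ→ℚ 256 * s ³ * (s - ℕ→ℚ j) ²) ∎
  where
  s = ℕ→ℚ (suc n)
  a = poch ½ (suc n) ³
  b = poch ½ (2 ℕ.* suc n ℕ.+ j)
  shift : s * falling (ℕ→ℚ n) j ≡ falling s (suc j)
  shift = trans (cong (_* falling (ℕ→ℚ n) j) (ℕ→ℚ-suc n))
    (trans (sym (falling-suc (ℕ→ℚ n) j)) (cong (λ x → falling x (suc j)) (sym (ℕ→ℚ-suc n))))

-- The WZ equation with the common factor `weight n j` removed, of degree five in w, n and j. At w =
-- ½ the sum w + w is 1, so that j + (w + w) is the shifted parameter.
wz-polynomial : ∀ w n j → (w + j) ³ * linear w n j
     - (n + n + j + w) * (n - j) ² * linear w n (j + (w + w))
   ≡ ℕ→ℚ 4 * (n + w) ³ * ((n + n + j + w) * (n + n + j + w + (w + w))) - ℕ→ℚ 256 * n ³ * (n - j) ²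
wz-polynomial = solve 3 (λ w n j →
    let lin = λ j → con (+ 120) :* n :* n :- con (+ 84) :* j :* n :+ con (+ 68) :* w :* n :- con (+ 20) :* w :* j :+ con (+ 12) :* w :* w
        sq = λ x → x :* x
        cube = λ x → x :* x :* x in
    cube (w :+ j) :* lin j :- (n :+ n :+ j :+ w) :* sq (n :- j) :* lin (j :+ (w :+ w))
    := con (+ 4) :* cube (n :+ w) :* ((n :+ n :+ j :+ w) :* (n :+ n :+ j :+ w :+ (w :+ w))) :- con (+ 256) :* cube n :* sq (n :- j))
  refl

ℕ→ℚ-2n+j : ∀ n j → ℕ→ℚ (2 ℕ.* n ℕ.+ j) ≡ ℕ→ℚ n + ℕ→ℚ n + ℕ→ℚ j
ℕ→ℚ-2n+j n j = trans (ℕ→ℚ-+ (2 ℕ.* n) j) (cong (_+ ℕ→ℚ j)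
  (trans (cong (λ x → ℕ→ℚ (n ℕ.+ x)) (ℕₚ.+-identityʳ n)) (ℕ→ℚ-+ n n)))

-- All four terms are polynomial multiples of `weight n j`: raising j brings in (2n + j + ½)(n -
-- j)², raising n in F gives 4 (n + ½)³ (2n + j + ½)(2n + j + 3/2), and `F j n` itself is treated by
-- `F-weight`.
wz : ∀ j n → (½ + ℕ→ℚ j) ³ * G j n - G (suc j) n ≡ F j (suc n) - F j n
wz j n = begin
  (½ + y) ³ * G j n - G (suc j) n
    ≡⟨ cong (λ u → (½ + y) ³ * G j n - u) shifted ⟩
  (½ + y) ³ * (weight n j * linear ½ x y) - weight n j * ((x + x + y + ½) * (x - y) ² * linear ½ x (y + (½ + ½)))
    ≡⟨ solve 5 (λ c k l m u → c :* (k :* l) :- k :* (m :* u) := k :* (c :* l :- m :* u)) refl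
         ((½ + y) ³) (weight n j) (linear ½ x y) ((x + x + y + ½) * (x - y) ²) (linear ½ x (y + (½ + ½))) ⟩
  weight n j * ((½ + y) ³ * linear ½ x y - (x + x + y + ½) * (x - y) ² * linear ½ x (y + (½ + ½)))
    ≡⟨ cong (weight n j *_) (wz-polynomial ½ x y) ⟩
  weight n j * (ℕ→ℚ 4 * (x + ½) ³ * ((x + x + y + ½) * (x + x + y + ½ + (½ + ½))) - ℕ→ℚ 256 * x ³ * (x - y) ²)
    ≡⟨ solve 8 (λ a b f i h x z r → (a :* a :* a) :* b :* (f :* f) :* i :* (con (+ 4) :* ((x :+ h) :* (x :+ h) :* (x :+ h)) :* ((z :+ h) :* (z :+ h :+ (h :+ h))) :- r)
         := con (+ 4) :* ((a :* (h :+ x)) :* (a :* (h :+ x)) :* (a :* (h :+ x))) :* (b :* (h :+ z) :* (h :+ (h :+ h :+ z))) :* (f :* f) :* i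
            :- (a :* a :* a) :* b :* (f :* f) :* i :* r) refl
         (poch ½ n) (poch ½ (2 ℕ.* n ℕ.+ j)) (falling x j) (invDen n) ½ x (x + x + y) (ℕ→ℚ 256 * x ³ * (x - y) ²) ⟩
  ℕ→ℚ 4 * poch ½ (suc n) ³ * (poch ½ (2 ℕ.* n ℕ.+ j) * (½ + (x + x + y)) * (½ + (½ + ½ + (x + x + y)))) * falling x j ² * invDen n
    - weight n j * (ℕ→ℚ 256 * x ³ * (x - y) ²)
    ≡⟨ cong₂ (λ u v → ℕ→ℚ 4 * poch ½ (suc n) ³ * u * falling x j ² * invDen n - v) (sym twice) (sym (F-weight j n)) ⟩
  F j (suc n) - F j n ∎
  where
  x = ℕ→ℚ n
  y = ℕ→ℚ j
  k = 2 ℕ.* n ℕ.+ j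
  twice : poch ½ (2 ℕ.* suc n ℕ.+ j) ≡ poch ½ k * (½ + (x + x + y)) * (½ + (½ + ½ + (x + x + y)))
  twice = begin
    poch ½ (2 ℕ.* suc n ℕ.+ j)                               ≡⟨ cong (λ l → poch ½ (suc (l ℕ.+ j))) (ℕₚ.+-suc n (n ℕ.+ 0)) ⟩
    poch ½ k * (½ + ℕ→ℚ k) * (½ + ℕ→ℚ (suc k))               ≡⟨ cong (λ u → poch ½ k * (½ + ℕ→ℚ k) * (½ + u)) (ℕ→ℚ-suc k) ⟩
    poch ½ k * (½ + ℕ→ℚ k) * (½ + (½ + ½ + ℕ→ℚ k))           ≡⟨ cong (λ u → poch ½ k * (½ + u) * (½ + (½ + ½ + u))) (ℕ→ℚ-2n+j n j) ⟩
    poch ½ k * (½ + (x + x + y)) * (½ + (½ + ½ + (x + x + y))) ∎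
  shifted : G (suc j) n ≡ weight n j * ((x + x + y + ½) * (x - y) ² * linear ½ x (y + (½ + ½)))
  shifted = begin
    poch ½ n ³ * poch ½ (2 ℕ.* n ℕ.+ suc j) * (falling x j * (x - y)) ² * invDen n * linear ½ x (ℕ→ℚ (suc j))
      ≡⟨ cong₂ (λ u v → poch ½ n ³ * poch ½ u * (falling x j * (x - y)) ² * invDen n * linear ½ x v) (ℕₚ.+-suc (2 ℕ.* n) j) (trans (ℕ→ℚ-suc j) (ℚₚ.+-comm 1ℚ y)) ⟩
    poch ½ n ³ * (poch ½ k * (½ + ℕ→ℚ k)) * (falling x j * (x - y)) ² * invDen n * linear ½ x (y + (½ + ½))
      ≡⟨ cong (λ u → poch ½ n ³ * (poch ½ k * (½ + u)) * (falling x j * (x - y)) ² * invDen n * linear ½ x (y + (½ + ½))) (ℕ→ℚ-2n+j n j) ⟩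
    poch ½ n ³ * (poch ½ k * (½ + (x + x + y))) * (falling x j * (x - y)) ² * invDen n * linear ½ x (y + (½ + ½))
      ≡⟨ solve 8 (λ a b h z f d i l → a :* (b :* (h :+ z)) :* ((f :* d) :* (f :* d)) :* i :* l := a :* b :* (f :* f) :* i :* ((z :+ h) :* (d :* d) :* l)) refl
           (poch ½ n ³) (poch ½ k) ½ (x + x + y) (falling x j) (x - y) (invDen n) (linear ½ x (y + (½ + ½))) ⟩
    weight n j * ((x + x + y + ½) * (x - y) ² * linear ½ x (y + (½ + ½))) ∎

-- The right-hand side of `wz` telescopes, and the lower boundary value `F j 0` is 0.
wz-sum : ∀ j N → (½ + ℕ→ℚ j) ³ * sumTo N (G j) - sumTo N (G (suc j)) ≡ F j N
wz-sum j zero    = solve 1 (λ c → c :* con (+ 0) :- con (+ 0) := con (+ 0)) refl ((½ + ℕ→ℚ j) ³)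
wz-sum j (suc N) = begin
  c * (sumTo N (G j) + G j N) - (sumTo N (G (suc j)) + G (suc j) N)
    ≡⟨ solve 5 (λ c s g t h → c :* (s :+ g) :- (t :+ h) := (c :* s :- t) :+ (c :* g :- h)) refl c (sumTo N (G j)) (G j N) (sumTo N (G (suc j))) (G (suc j) N) ⟩
  (c * sumTo N (G j) - sumTo N (G (suc j))) + (c * G j N - G (suc j) N)
    ≡⟨ cong₂ _+_ (wz-sum j N) (wz j N) ⟩
  F j N + (F j (suc N) - F j N)
    ≡⟨ solve 2 (λ u v → u :+ (v :- u) := v) refl (F j N) (F j (suc N)) ⟩
  F j (suc N) ∎
  where c = (½ + ℕ→ℚ j) ³

term-G : ∀ n → term n ≡ G 0 n
term-G n = begin
  a * a * a * poch ½ (2 ℕ.* n) * ℕ→ℚ (120 ℕ.* n ℕ.* n ℕ.+ 34 ℕ.* n ℕ.+ 3) * invDen n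
    ≡⟨ cong₂ (λ u v → a * a * a * poch ½ u * v * invDen n) (sym (ℕₚ.+-identityʳ (2 ℕ.* n))) lin ⟩
  a * a * a * poch ½ (2 ℕ.* n ℕ.+ 0) * linear ½ (ℕ→ℚ n) 0ℚ * invDen n
    ≡⟨ solve 4 (λ a b l i → a :* a :* a :* b :* l :* i := a :* a :* a :* b :* (con (+ 1) :* con (+ 1)) :* i :* l) refl a (poch ½ (2 ℕ.* n ℕ.+ 0)) (linear ½ (ℕ→ℚ n) 0ℚ) (invDen n) ⟩
  G 0 n ∎
  where
  a = poch ½ n
  lin : ℕ→ℚ (120 ℕ.* n ℕ.* n ℕ.+ 34 ℕ.* n ℕ.+ 3) ≡ linear ½ (ℕ→ℚ n) 0ℚ
  lin = begin
    ℕ→ℚ (120 ℕ.* n ℕ.* n ℕ.+ 34 ℕ.* n ℕ.+ 3)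
      ≡⟨ trans (ℕ→ℚ-+ (120 ℕ.* n ℕ.* n ℕ.+ 34 ℕ.* n) 3) (cong (_+ ℕ→ℚ 3) (ℕ→ℚ-+ (120 ℕ.* n ℕ.* n) (34 ℕ.* n))) ⟩
    ℕ→ℚ (120 ℕ.* n ℕ.* n) + ℕ→ℚ (34 ℕ.* n) + ℕ→ℚ 3
      ≡⟨ cong₂ (λ u v → u + v + ℕ→ℚ 3) (trans (ℕ→ℚ-* (120 ℕ.* n) n) (cong (_* ℕ→ℚ n) (ℕ→ℚ-* 120 n))) (ℕ→ℚ-* 34 n) ⟩
    ℕ→ℚ 120 * ℕ→ℚ n * ℕ→ℚ n + ℕ→ℚ 34 * ℕ→ℚ n + ℕ→ℚ 3
      -- The closed terms `ℕ→ℚ 68 * ½` and `ℕ→ℚ 12 * ½ * ½` compute to 34 and 3; the solver sees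
      -- them as c and d.
      ≡⟨ solve 4 (λ n c d h → con (+ 120) :* n :* n :+ c :* n :+ d
           := con (+ 120) :* n :* n :- con (+ 84) :* con (+ 0) :* n :+ c :* n :- con (+ 20) :* h :* con (+ 0) :+ d)
           refl (ℕ→ℚ n) (ℕ→ℚ 68 * ½) (ℕ→ℚ 12 * ½ * ½) ½ ⟩
    linear ½ (ℕ→ℚ n) 0ℚ ∎

sumTo-cong : ∀ {f g} → (∀ n → f n ≡ g n) → ∀ N → sumTo N f ≡ sumTo N g
sumTo-cong f≗g zero    = refl
sumTo-cong f≗g (suc N) = cong₂ _+_ (sumTo-cong f≗g N) (f≗g N)

-- Reduction modulo powers of p

module Odd (m : ℕ) (m>0 : m > 0) (pr : Prime (suc (m ℕ.+ m))) where

  p : ℕ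
  p = suc (m ℕ.+ m)

  open Local p pr

  q w : ℚ
  q = ½ + ℕ→ℚ m
  w = ℕ→ℚ (4 ℕ.^ m)

  R : ℤ → ℚ
  R a = poch (1ℚ + ℤ→ℚ a * q) m

  q+q : q + q ≡ ℕ→ℚ p
  q+q = trans (solve 2 (λ h m → (h :+ m) :+ (h :+ m) := (h :+ h) :+ (m :+ m)) refl ½ (ℕ→ℚ m))
    (trans (cong (λ x → 1ℚ + x) (sym (ℕ→ℚ-+ m m))) (sym (ℕ→ℚ-suc (m ℕ.+ m))))

  p∤< : ∀ {n} → suc n ℕ.< p → ¬ (p ∣ suc n)
  p∤< n<p p∣n = ℕₚ.<⇒≱ n<p (∣⇒≤ p∣n)

  p∤2 : ¬ (p ∣ 2)
  p∤2 = p∤< (ℕ.s≤s (ℕₚ.+-mono-≤ m>0 m>0))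

  p∤^ : ∀ {a} → ¬ (p ∣ a) → ∀ k → ¬ (p ∣ a ℕ.^ k)
  p∤^ p∤a zero    = p∤1
  p∤^ p∤a (suc k) = p∤-* p∤a (p∤^ p∤a k)

  p∤! : ∀ n → n ℕ.< p → ¬ (p ∣ n !)
  p∤! zero    _   = p∤1
  p∤! (suc n) n<p = p∤-* (p∤< n<p) (p∤! n (ℕₚ.<-trans (ℕₚ.n<1+n n) n<p))

  -- Powers of p dividing the summands

  int-½ : Integral ½
  int-½ = /-integral (+ 1) 2 p∤2

  int-ℤ : ∀ a → Integral (ℤ→ℚ a)
  int-ℤ a = /-integral a 1 p∤1

  div-q : Divides 1 q
  div-q = div-cancel 2 p∤2 (subst (Divides 1)
    (trans (sym q+q) (solve 1 (λ q → q :+ q := con (+ 2) :* q) refl q)) div-p)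

  int-q : Integral q
  int-q = div-weaken 1 div-q

  int-poch : ∀ {a} → Integral a → ∀ n → Integral (poch a n)
  int-poch ia zero    = ℕ-integral 1
  int-poch ia (suc n) = div-* (int-poch ia n) (div-+ ia (ℕ-integral n))

  int-falling : ∀ {a} → Integral a → ∀ n → Integral (falling a n)
  int-falling ia zero    = ℕ-integral 1
  int-falling ia (suc n) = div-* (int-falling ia n) (div-- ia (ℕ-integral n))

  int-invDen : ∀ {n} → n ℕ.< p → Integral (invDen n)
  int-invDen {n} n<p = /-integral (+ 1) (den n)
    {{m*n≢0 ((n !) ℕ.^ 5) (2 ℕ.^ (6 ℕ.* n)) {{m^n≢0 (n !) 5 {{n !≢0}}}} {{m^n≢0 2 (6 ℕ.* n)}}}}
    (p∤-* (p∤^ (p∤! n n<p) 5) (p∤^ p∤2 (6 ℕ.* n)))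

  int-linear : ∀ {x y} → Integral x → Integral y → Integral (linear ½ x y)
  int-linear ix iy = div-+ (div-- (div-+ (div-- (n 120 ⊗ ix ⊗ ix) (n 84 ⊗ iy ⊗ ix)) (n 68 ⊗ int-½ ⊗ ix))
    (n 20 ⊗ int-½ ⊗ iy)) (n 12 ⊗ int-½ ⊗ int-½)
    where
    infixl 7 _⊗_
    _⊗_ : ∀ {x y} → Integral x → Integral y → Integral (x * y)
    _⊗_ = div-*
    n = ℕ-integral

  div-³ : ∀ {x} → Divides 1 x → Divides 3 (x ³)
  div-³ d = div-* (div-* d d) d

  -- The factor of index m is ½ + m = p/2.
  div-poch : ∀ {n} → m ℕ.< n → Divides 1 (poch ½ n)
  div-poch {n} m<n with ℕₚ.m≤n⇒∃[o]m+o≡n m<n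
  ... | o , refl = subst (Divides 1) (sym (poch-+ ½ (suc m) o))
    (div-* {1} {0} (div-* {0} {1} (int-poch int-½ m) div-q) (int-poch (div-+ int-½ (ℕ-integral (suc m))) o))

  -- Besides p/2 at index m, the product contains ½ + m + p = 3p/2 at index m + p.
  div²-poch : ∀ {n} → m ℕ.+ p ℕ.< n → Divides 2 (poch ½ n)
  div²-poch {n} m+p<n with ℕₚ.m≤n⇒∃[o]m+o≡n m+p<n
  ... | o , refl = subst (Divides 2) (sym (poch-+ ½ (suc (m ℕ.+ p)) o))
    (div-* {2} {0} (div-* {1} {1} (div-poch m<m+p) 3p/2)
      (int-poch (div-+ int-½ (ℕ-integral (suc (m ℕ.+ p)))) o))
    where
    m<m+p : m ℕ.< m ℕ.+ p
    m<m+p = ℕₚ.m<m+n m ℕ.z<s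
    3p/2 : Divides 1 (½ + ℕ→ℚ (m ℕ.+ p))
    3p/2 = subst (Divides 1) (trans (ℚₚ.+-assoc ½ (ℕ→ℚ m) (ℕ→ℚ p)) (cong (λ x → ½ + x) (sym (ℕ→ℚ-+ m p)))) (div-+ div-q div-p)

  -- The cube of `poch ½ p` supplies p³ and the symbol of length 2p + j supplies p². The denominator
  -- in `F j p` is that of index p - 1, hence prime to p.
  div-F : ∀ j → Divides 5 (F j p)
  div-F j = div-* {5} {0} (div-* {5} {0} (div-* {3} {2} (div-* {0} {3} (ℕ-integral 4)
      (div-³ (div-poch (ℕ.s≤s (ℕₚ.m≤m+n m m))))) (div²-poch bound))
      (div-* ff ff)) (int-invDen (ℕₚ.n<1+n (m ℕ.+ m)))
    where
    ff = int-falling (ℕ-integral (m ℕ.+ m)) j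
    bound : m ℕ.+ p ℕ.< 2 ℕ.* p ℕ.+ j
    bound = ℕₚ.≤-trans (ℕₚ.+-mono-≤ (ℕ.s≤s (ℕₚ.m≤m+n m m)) (ℕₚ.≤-reflexive (sym (ℕₚ.+-identityʳ p)))) (ℕₚ.m≤m+n (2 ℕ.* p) j)

  -- Again p³ comes from the cube and p² from the symbol of length 2n + m. The latter just suffices:
  -- for n = m + 1 the length is 3m + 2 = m + p + 1.
  div-G : ∀ {n} → m ℕ.< n → n ℕ.< p → Divides 5 (G m n)
  div-G {n} m<n n<p = div-* {5} {0} (div-* {5} {0} (div-* {5} {0} (div-* {3} {2}
      (div-³ (div-poch m<n)) (div²-poch bound)) (div-* ff ff)) (int-invDen n<p))
      (int-linear (ℕ-integral n) (ℕ-integral m))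
    where
    ff = int-falling (ℕ-integral n) m
    bound : m ℕ.+ p ℕ.< 2 ℕ.* n ℕ.+ m
    bound = ℕₚ.≤-trans (ℕₚ.≤-reflexive (ℕₛ.solve 1 (λ m → ℕₛ.con 1 ℕₛ.:+ (m ℕₛ.:+ (ℕₛ.con 1 ℕₛ.:+ (m ℕₛ.:+ m)))
      ℕₛ.:= ℕₛ.con 2 ℕₛ.:* (ℕₛ.con 1 ℕₛ.:+ m) ℕₛ.:+ m) refl m)) (ℕₚ.+-monoˡ-≤ m (ℕₚ.*-monoʳ-≤ 2 m<n))

  -- Shifting the sum to its single surviving term

  S : ℚ
  S = sumTo p (G 0)

  -- Each step multiplies by (½ + j)³, which extends the cube of `poch ½ j`, and adds the boundary
  -- term `F j p`, a multiple of p⁵.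
  shift-S : ∀ j → Divides 5 (poch ½ j ³ * S - sumTo p (G j))
  shift-S zero    = subst (Divides 5) (solve 1 (λ s → con (+ 0) := con (+ 1) :* con (+ 1) :* con (+ 1) :* s :- s) refl S) (div-0 5)
  shift-S (suc j) = subst (Divides 5)
    (trans (cong (λ x → (½ + ℕ→ℚ j) ³ * (poch ½ j ³ * S - sumTo p (G j)) + x) (sym (wz-sum j p)))
      (solve 5 (λ h a s t u → let cube = λ x → x :* x :* x in
        cube h :* (cube a :* s :- t) :+ (cube h :* t :- u) := cube (a :* h) :* s :- u) refl
        (½ + ℕ→ℚ j) (poch ½ j) S (sumTo p (G j)) (sumTo p (G (suc j)))))
    (div-+ (div-* {0} {5} (div-* (div-* h h) h) (shift-S j)) (div-F j))
    where h = div-+ int-½ (ℕ-integral j)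

  G-< : ∀ {n} → n ℕ.< m → G m n ≡ 0ℚ
  G-< {n} n<m = trans (cong (λ f → poch ½ n ³ * poch ½ (2 ℕ.* n ℕ.+ m) * f ² * invDen n * linear ½ (ℕ→ℚ n) (ℕ→ℚ m)) (falling-< n<m))
    (solve 4 (λ a b i l → a :* b :* (con (+ 0) :* con (+ 0)) :* i :* l := con (+ 0)) refl
      (poch ½ n ³) (poch ½ (2 ℕ.* n ℕ.+ m)) (invDen n) (linear ½ (ℕ→ℚ n) (ℕ→ℚ m)))

  sum-G-< : ∀ N → N ℕ.≤ m → sumTo N (G m) ≡ 0ℚ
  sum-G-< zero    _   = refl
  sum-G-< (suc N) N<m = cong₂ _+_ (sum-G-< N (ℕₚ.<⇒≤ N<m)) (G-< N<m)

  -- Here i counts the terms after n = m; i = m reaches the last index 2m = p - 1.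
  sum-G : ∀ i → i ℕ.≤ m → Divides 5 (sumTo (suc (m ℕ.+ i)) (G m) - G m m)
  sum-G zero    _   = subst (Divides 5) (sym eq) (div-0 5)
    where
    eq : sumTo (suc (m ℕ.+ 0)) (G m) - G m m ≡ 0ℚ
    eq = trans (cong (λ k → sumTo (suc k) (G m) - G m m) (ℕₚ.+-identityʳ m))
      (trans (cong (λ s → s + G m m - G m m) (sum-G-< m ℕₚ.≤-refl)) (solve 1 (λ g → con (+ 0) :+ g :- g := con (+ 0)) refl (G m m)))
  sum-G (suc i) i<m = subst (λ k → Divides 5 (sumTo (suc k) (G m) - G m m)) (sym (ℕₚ.+-suc m i))
    (subst (Divides 5) (solve 3 (λ s g h → (s :- g) :+ h := (s :+ h) :- g) refl (sumTo (suc (m ℕ.+ i)) (G m)) (G m m) (G m (suc (m ℕ.+ i))))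
      (div-+ (sum-G i (ℕₚ.<⇒≤ i<m)) (div-G (ℕ.s≤s (ℕₚ.m≤m+n m i)) (ℕ.s≤s (ℕₚ.+-monoʳ-< m i<m)))))

  S≡G : Divides 5 (poch ½ m ³ * S - G m m)
  S≡G = subst (Divides 5) (solve 3 (λ a b c → (a :- b) :+ (b :- c) := a :- c) refl (poch ½ m ³ * S) (sumTo p (G m)) (G m m))
    (div-+ (shift-S m) (sum-G m ℕₚ.≤-refl))

  -- Expansions modulo p³

  e₁ e₂ : ℕ → ℚ
  e₁ zero    = 0ℚ
  e₁ (suc n) = e₁ n * (1ℚ + ℕ→ℚ n) + poch 1ℚ n
  e₂ zero    = 0ℚ
  e₂ (suc n) = e₂ n * (1ℚ + ℕ→ℚ n) + e₁ n

  int-1+ : ∀ n → Integral (1ℚ + ℕ→ℚ n)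
  int-1+ n = div-+ (ℕ-integral 1) (ℕ-integral n)

  int-e₁ : ∀ n → Integral (e₁ n)
  int-e₁ zero    = ℕ-integral 0
  int-e₁ (suc n) = div-+ (div-* (int-e₁ n) (int-1+ n)) (int-poch (ℕ-integral 1) n)

  int-e₂ : ∀ n → Integral (e₂ n)
  int-e₂ zero    = ℕ-integral 0
  int-e₂ (suc n) = div-+ (div-* (int-e₂ n) (int-1+ n)) (int-e₁ n)

  -- `e₁ n` and `e₂ n` are the coefficients of x and x² in the product of i + x over 1 ≤ i ≤ n, here
  -- taken at x = aq. Multiplying the truncated expansion by 1 + n + aq creates just one term beyond
  -- x², namely `e₂ n` times a³q³.
  taylor : ∀ a n → Divides 3 (poch (1ℚ + ℤ→ℚ a * q) n - (poch 1ℚ n + ℤ→ℚ a * e₁ n * q + ℤ→ℚ a * ℤ→ℚ a * e₂ n * q ²))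
  taylor a zero    = subst (Divides 3) (solve 2 (λ α q → con (+ 0) := con (+ 1) :- (con (+ 1) :+ α :* con (+ 0) :* q :+ α :* α :* con (+ 0) :* (q :* q))) refl (ℤ→ℚ a) q) (div-0 3)
  taylor a (suc n) = subst (Divides 3)
    (solve 7 (λ x α q n a b c → let val = λ a b c → a :+ α :* b :* q :+ α :* α :* c :* (q :* q) ; s = con (+ 1) :+ n in
       (x :- val a b c) :* (con (+ 1) :+ α :* q :+ n) :+ c :* (α :* α :* α) :* (q :* q :* q)
       := x :* (con (+ 1) :+ α :* q :+ n) :- val (a :* s) (b :* s :+ a) (c :* s :+ b)) refl
       (poch (1ℚ + α * q) n) α q (ℕ→ℚ n) (poch 1ℚ n) (e₁ n) (e₂ n))
    (div-+ (div-* {3} {0} (taylor a n) (div-+ (div-+ (ℕ-integral 1) (div-* (int-ℤ a) int-q)) (ℕ-integral n)))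
      (div-* {0} {3} (div-* (int-e₂ n) (div-* (div-* (int-ℤ a) (int-ℤ a)) (int-ℤ a))) (div-³ div-q)))
    where α = ℤ→ℚ a

  f 1/f : ℚ
  f = ℕ→ℚ (m !)
  1/f = recip (m !) {{m !≢0}}

  f*1/f : f * 1/f ≡ 1ℚ
  f*1/f = *-recip (m !) {{m !≢0}}

  p∤m! : ¬ (p ∣ m !)
  p∤m! = p∤! m (ℕ.s≤s (ℕₚ.m≤m+n m m))

  int-1/f : Integral 1/f
  int-1/f = /-integral (+ 1) (m !) {{m !≢0}} p∤m!

  ρ : ℤ → ℚ
  ρ a = 1/f * R a

  R≡fρ : ∀ a → R a ≡ f * ρ a
  R≡fρ a = trans (sym (ℚₚ.*-identityˡ (R a))) (trans (cong (_* R a) (sym f*1/f)) (ℚₚ.*-assoc f 1/f (R a)))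

  -- After division by m! these are the harmonic number 1 + 1/2 + ⋯ + 1/m and the sum of 1/(ij) over
  -- 1 ≤ i < j ≤ m.
  η₁ η₂ : ℚ
  η₁ = 1/f * e₁ m
  η₂ = 1/f * e₂ m

  int-η₁ : Integral η₁
  int-η₁ = div-* int-1/f (int-e₁ m)

  int-η₂ : Integral η₂
  int-η₂ = div-* int-1/f (int-e₂ m)

  value : ℤ → ℤ → ℤ → ℚ
  value s t r = 1ℚ + ℤ→ℚ s * η₁ * q + (ℤ→ℚ t * η₂ + ℤ→ℚ r * η₁ ²) * q ²

  int-value : ∀ s t r → Integral (value s t r)
  int-value s t r = div-+ (div-+ (ℕ-integral 1) (div-* (div-* (int-ℤ s) int-η₁) int-q))
    (div-* (div-+ (div-* (int-ℤ t) int-η₂) (div-* (int-ℤ r) (div-* int-η₁ int-η₁))) (div-* int-q int-q))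

  -- A product of factors ρ a = 1 + a η₁ q + a² η₂ q² + ⋯ agrees modulo p³ with value s t r,
  -- where s, t and r are the sum, the sum of squares and the second elementary symmetric function of the arguments a.
  record HasJet (x : ℚ) (s t r : ℤ) : Set where
    constructor hasJet
    field
      error : Divides 3 (x - value s t r)
  open HasJet

  int-jet : ∀ {x s t r} → HasJet x s t r → Integral x
  int-jet {x} {s} {t} {r} h = subst Integral (solve 2 (λ x v → (x :- v) :+ v := x) refl x (value s t r))
    (div-+ (div-weaken 3 (error h)) (int-value s t r))

  -- The linear parts multiply to s s′ η₁² q², which is the growth of the second elementary
  -- symmetric function. The remaining cross terms contain q³.
  jet-* : ∀ {x y s t r s′ t′ r′} → HasJet x s t r → HasJet y s′ t′ r′ →
          HasJet (x * y) (s ℤ.+ s′) (t ℤ.+ t′) (r ℤ.+ r′ ℤ.+ s ℤ.* s′)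
  jet-* {x} {y} {s} {t} {r} {s′} {t′} {r′} h i = hasJet (subst (Divides 3) (trans expand (cong (λ v → x * y - v) (sym homomorphic)))
    (div-+ (div-+ (div-* {3} {0} (error h) (int-jet i)) (div-* {0} {3} (int-value s t r) (error i)))
      (div-* {0} {3} (div-+ (div-+ (div-* (div-* (int-ℤ s) int-η₁) (int-c t′ r′)) (div-* (int-c t r) (div-* (int-ℤ s′) int-η₁)))
        (div-* (div-* (int-c t r) (int-c t′ r′)) int-q)) (div-³ div-q))))
    where
    c : ℤ → ℤ → ℚ
    c t r = ℤ→ℚ t * η₂ + ℤ→ℚ r * η₁ ²
    int-c : ∀ t r → Integral (c t r)
    int-c t r = div-+ (div-* (int-ℤ t) int-η₂) (div-* (int-ℤ r) (div-* int-η₁ int-η₁))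
    product : ℚ
    product = 1ℚ + (ℤ→ℚ s + ℤ→ℚ s′) * η₁ * q + ((ℤ→ℚ t + ℤ→ℚ t′) * η₂ + (ℤ→ℚ r + ℤ→ℚ r′ + ℤ→ℚ s * ℤ→ℚ s′) * η₁ ²) * q ²
    homomorphic : value (s ℤ.+ s′) (t ℤ.+ t′) (r ℤ.+ r′ ℤ.+ s ℤ.* s′) ≡ product
    homomorphic = trans (cong₂ (λ σ τ → 1ℚ + σ * η₁ * q + (τ * η₂ + ℤ→ℚ (r ℤ.+ r′ ℤ.+ s ℤ.* s′) * η₁ ²) * q ²) (ℤ→ℚ-+ s s′) (ℤ→ℚ-+ t t′))
      (cong (λ u → 1ℚ + (ℤ→ℚ s + ℤ→ℚ s′) * η₁ * q + ((ℤ→ℚ t + ℤ→ℚ t′) * η₂ + u * η₁ ²) * q ²)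
        (trans (ℤ→ℚ-+ (r ℤ.+ r′) (s ℤ.* s′)) (cong₂ _+_ (ℤ→ℚ-+ r r′) (ℤ→ℚ-* s s′))))
    expand : (x - value s t r) * y + value s t r * (y - value s′ t′ r′)
             + (ℤ→ℚ s * η₁ * c t′ r′ + c t r * (ℤ→ℚ s′ * η₁) + c t r * c t′ r′ * q) * q ³ ≡ x * y - product
    expand = begin
      (x - value s t r) * y + value s t r * (y - value s′ t′ r′) + (ℤ→ℚ s * η₁ * c t′ r′ + c t r * (ℤ→ℚ s′ * η₁) + c t r * c t′ r′ * q) * q ³
        ≡⟨ solve 8 (λ x y s η c s′ c′ q → let v = con (+ 1) :+ s :* η :* q :+ c :* (q :* q) ; v′ = con (+ 1) :+ s′ :* η :* q :+ c′ :* (q :* q) in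
             (x :- v) :* y :+ v :* (y :- v′) :+ (s :* η :* c′ :+ c :* (s′ :* η) :+ c :* c′ :* q) :* (q :* q :* q)
             := x :* y :- (con (+ 1) :+ (s :+ s′) :* η :* q :+ (c :+ c′ :+ s :* s′ :* (η :* η)) :* (q :* q))) refl
             x y (ℤ→ℚ s) η₁ (c t r) (ℤ→ℚ s′) (c t′ r′) q ⟩
      x * y - (1ℚ + (ℤ→ℚ s + ℤ→ℚ s′) * η₁ * q + (c t r + c t′ r′ + ℤ→ℚ s * ℤ→ℚ s′ * η₁ ²) * q ²)
        ≡⟨ cong (λ u → x * y - (1ℚ + (ℤ→ℚ s + ℤ→ℚ s′) * η₁ * q + u * q ²))
             (solve 7 (λ t t′ η₂ r r′ n σ → (t :* η₂ :+ r :* n) :+ (t′ :* η₂ :+ r′ :* n) :+ σ :* n := (t :+ t′) :* η₂ :+ (r :+ r′ :+ σ) :* n) refl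
               (ℤ→ℚ t) (ℤ→ℚ t′) η₂ (ℤ→ℚ r) (ℤ→ℚ r′) (η₁ ²) (ℤ→ℚ s * ℤ→ℚ s′)) ⟩
      x * y - product ∎

  -- This is `taylor` divided by m!; a single argument forms no pairs, so r = 0.
  jet-ρ : ∀ a → HasJet (ρ a) a (a ℤ.* a) (+ 0)
  jet-ρ a = hasJet (subst (Divides 3) (trans normalise (cong₂ (λ o τ → ρ a - (o + α * η₁ * q + (τ * η₂ + 0ℚ * η₁ ²) * q ²))
      (trans (cong (1/f *_) (poch-! m)) (trans (ℚₚ.*-comm 1/f f) f*1/f)) (sym (ℤ→ℚ-* a a))))
    (div-* {0} {3} int-1/f (taylor a m)))
    where
    α = ℤ→ℚ a
    normalise : 1/f * (R a - (poch 1ℚ m + α * e₁ m * q + α * α * e₂ m * q ²))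
                ≡ ρ a - (1/f * poch 1ℚ m + α * η₁ * q + (α * α * η₂ + 0ℚ * η₁ ²) * q ²)
    normalise = solve 7 (λ i x a e₀ e₁ e₂ q → i :* (x :- (e₀ :+ a :* e₁ :* q :+ a :* a :* e₂ :* (q :* q)))
      := i :* x :- (i :* e₀ :+ a :* (i :* e₁) :* q :+ (a :* a :* (i :* e₂) :+ con (+ 0) :* ((i :* e₁) :* (i :* e₁))) :* (q :* q)))
      refl 1/f (R a) α (poch 1ℚ m) (e₁ m) (e₂ m) q

  -- Reflection and duplication

  -- Reflecting the second factor makes it continue the first, so that the left side is a signed
  -- symbol of length 2m at 1 + 2aq = 2b, with b = ½ + aq. Duplication splits it into the symbols at
  -- b and b + ½ = 1 + aq, and reflection of the one at b gives R(-1 - a) and cancels the sign.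
  R-duplication : ∀ a → R (a ℤ.+ a) * R (ℤ.- (+ 2) ℤ.- (a ℤ.+ a)) ≡ w * (R (ℤ.- (+ 1) ℤ.- a) * R a)
  R-duplication a = begin
    R (a ℤ.+ a) * R (ℤ.- (+ 2) ℤ.- (a ℤ.+ a))
      ≡⟨ cong (λ x → R (a ℤ.+ a) * x) (sym (unsign (poch (1ℚ + ℤ→ℚ (a ℤ.+ a) * q + ℕ→ℚ m) m) _
           (trans (poch-reflect _ m) (cong (λ x → signed m * poch x m) eq₁)))) ⟩
    R (a ℤ.+ a) * (signed m * poch (1ℚ + ℤ→ℚ (a ℤ.+ a) * q + ℕ→ℚ m) m)
      ≡⟨ solve 3 (λ x s y → x :* (s :* y) := s :* (x :* y)) refl (R (a ℤ.+ a)) (signed m) _ ⟩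
    signed m * (R (a ℤ.+ a) * poch (1ℚ + ℤ→ℚ (a ℤ.+ a) * q + ℕ→ℚ m) m)
      ≡⟨ cong (signed m *_) (sym (poch-+ (1ℚ + ℤ→ℚ (a ℤ.+ a) * q) m m)) ⟩
    signed m * poch (1ℚ + ℤ→ℚ (a ℤ.+ a) * q) (m ℕ.+ m)
      ≡⟨ cong (λ x → signed m * poch x (m ℕ.+ m)) eq₂ ⟩
    signed m * poch (b + b) (m ℕ.+ m)
      ≡⟨ cong (signed m *_) (poch-duplication b m) ⟩
    signed m * (w * (poch b m * poch (b + ½) m))
      ≡⟨ solve 4 (λ s w x y → s :* (w :* (x :* y)) := w :* ((s :* x) :* y)) refl (signed m) w (poch b m) (poch (b + ½) m) ⟩
    w * ((signed m * poch b m) * poch (b + ½) m)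
      ≡⟨ cong₂ (λ x y → w * (x * poch y m)) (unsign (poch b m) _ (trans (poch-reflect b m) (cong (λ x → signed m * poch x m) eq₃))) eq₄ ⟩
    w * (R (ℤ.- (+ 1) ℤ.- a) * R a) ∎
    where
    α = ℤ→ℚ a
    b = ½ + α * q
    unsign : ∀ x y → x ≡ signed m * y → signed m * x ≡ y
    unsign x y refl = trans (solve 2 (λ s y → s :* (s :* y) := (s :* s) :* y) refl (signed m) y)
      (trans (cong (_* y) (signed² m)) (ℚₚ.*-identityˡ y))
    hom : ∀ c → ℤ→ℚ (ℤ.- (+ c) ℤ.- a) ≡ - ℕ→ℚ c - α
    hom c = trans (ℤ→ℚ-+ (ℤ.- (+ c)) (ℤ.- a)) (cong₂ _+_ (ℤ→ℚ-neg (+ c)) (ℤ→ℚ-neg a))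
    hom₂ : ℤ→ℚ (ℤ.- (+ 2) ℤ.- (a ℤ.+ a)) ≡ - ℕ→ℚ 2 - (α + α)
    hom₂ = trans (ℤ→ℚ-+ (ℤ.- (+ 2)) (ℤ.- (a ℤ.+ a)))
      (cong₂ _+_ (ℤ→ℚ-neg (+ 2)) (trans (ℤ→ℚ-neg (a ℤ.+ a)) (cong -_ (ℤ→ℚ-+ a a))))
    eq₁ : 1ℚ - (1ℚ + ℤ→ℚ (a ℤ.+ a) * q + ℕ→ℚ m) - ℕ→ℚ m ≡ 1ℚ + ℤ→ℚ (ℤ.- (+ 2) ℤ.- (a ℤ.+ a)) * q
    eq₁ = trans (cong (λ x → 1ℚ - (1ℚ + x * q + ℕ→ℚ m) - ℕ→ℚ m) (ℤ→ℚ-+ a a))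
      -- Writing 1 as h + h and q as h + m turns the relation 2q = 2m + 1 into a polynomial
      -- identity.
      (trans (solve 3 (λ α h m → let one = h :+ h ; q = h :+ m in
          one :- (one :+ (α :+ α) :* q :+ m) :- m := one :+ (:- con (+ 2) :- (α :+ α)) :* q) refl α ½ (ℕ→ℚ m))
        (cong (λ x → 1ℚ + x * q) (sym hom₂)))
    eq₂ : 1ℚ + ℤ→ℚ (a ℤ.+ a) * q ≡ b + b
    eq₂ = trans (cong (λ x → 1ℚ + x * q) (ℤ→ℚ-+ a a))
      (solve 3 (λ α q h → h :+ h :+ (α :+ α) :* q := (h :+ α :* q) :+ (h :+ α :* q)) refl α q ½)
    eq₃ : 1ℚ - b - ℕ→ℚ m ≡ 1ℚ + ℤ→ℚ (ℤ.- (+ 1) ℤ.- a) * q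
    eq₃ = trans (solve 3 (λ α h m → let one = h :+ h ; q = h :+ m in
        one :- (h :+ α :* q) :- m := one :+ (:- con (+ 1) :- α) :* q) refl α ½ (ℕ→ℚ m))
      (cong (λ x → 1ℚ + x * q) (sym (hom 1)))
    eq₄ : b + ½ ≡ 1ℚ + α * q
    eq₄ = solve 2 (λ x h → h :+ x :+ h := h :+ h :+ x) refl (α * q) ½

  -- Twice the factor ½ + i is 2i + 1, which is less than p for i < m; so these symbols are units at
  -- p.
  cancel-poch : ∀ {k x} n → n ℕ.≤ m → Divides k (poch ½ n * x) → Divides k x
  cancel-poch {k} {x} zero    _   d = subst (Divides k) (ℚₚ.*-identityˡ x) d
  cancel-poch {k} {x} (suc n) n<m d = div-cancel (suc (n ℕ.+ n)) (p∤< (ℕ.s≤s (ℕₚ.+-mono-< n<m n<m)))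
    (subst (Divides k) eq (div-* {0} (ℕ-integral 2)
      (cancel-poch n (ℕₚ.<⇒≤ n<m) (subst (Divides k) (ℚₚ.*-assoc (poch ½ n) (½ + ℕ→ℚ n) x) d))))
    where
    eq : ℕ→ℚ 2 * ((½ + ℕ→ℚ n) * x) ≡ ℕ→ℚ (suc (n ℕ.+ n)) * x
    eq = trans (solve 3 (λ h n x → con (+ 2) :* ((h :+ n) :* x) := ((h :+ h) :+ (n :+ n)) :* x) refl ½ (ℕ→ℚ n) x)
      (cong (_* x) (sym (trans (ℕ→ℚ-suc (n ℕ.+ n)) (cong (λ y → 1ℚ + y) (ℕ→ℚ-+ n n)))))

  ρ-duplication : ∀ a → ρ (a ℤ.+ a) * ρ (ℤ.- (+ 2) ℤ.- (a ℤ.+ a)) ≡ w * (ρ (ℤ.- (+ 1) ℤ.- a) * ρ a)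
  ρ-duplication a = trans (solve 3 (λ i x y → i :* x :* (i :* y) := i :* i :* (x :* y)) refl 1/f (R (a ℤ.+ a)) (R (ℤ.- (+ 2) ℤ.- (a ℤ.+ a))))
    (trans (cong (1/f * 1/f *_) (R-duplication a))
      (solve 4 (λ i w x y → i :* i :* (w :* (x :* y)) := w :* (i :* x :* (i :* y))) refl 1/f w (R (ℤ.- (+ 1) ℤ.- a)) (R a)))

  R0-! : R (+ 0) ≡ ℕ→ℚ (m !)
  R0-! = trans (cong (λ x → poch x m) (solve 1 (λ q → con (+ 1) :+ con (+ 0) :* q := con (+ 1)) refl q)) (poch-! m)

  poch-½-R : poch ½ m ≡ signed m * R (ℤ.- (+ 1))
  poch-½-R = trans (poch-reflect ½ m) (cong (λ x → signed m * poch x m)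
    (solve 2 (λ h m → let one = h :+ h in one :- h :- m := one :+ con (ℤ.- (+ 1)) :* (h :+ m)) refl ½ (ℕ→ℚ m)))

  ρ₀ : ρ (+ 0) ≡ 1ℚ
  ρ₀ = trans (cong (1/f *_) R0-!) (trans (ℚₚ.*-comm 1/f f) f*1/f)

  -- Duplication at a = 0, where ρ(0) = 1 drops out on both sides.
  ρ₋₂ : ρ (ℤ.- (+ 2)) ≡ w * ρ (ℤ.- (+ 1))
  ρ₋₂ = begin
    d                ≡⟨ ℚₚ.*-identityˡ d ⟨
    1ℚ * d           ≡⟨ subst (λ x → x * d ≡ w * (a * x)) ρ₀ (ρ-duplication (+ 0)) ⟩
    w * (a * 1ℚ)     ≡⟨ cong (w *_) (ℚₚ.*-identityʳ a) ⟩
    w * a            ∎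
    where
    a = ρ (ℤ.- (+ 1))
    d = ρ (ℤ.- (+ 2))

  -- Up to sign, m! ρ(-1) is `poch ½ m`, a unit at p.
  cancel-ρ₋₁ : ∀ {k x} → Divides k (ρ (ℤ.- (+ 1)) * x) → Divides k x
  cancel-ρ₋₁ {k} {x} d = cancel-poch m ℕₚ.≤-refl (subst (Divides k)
    eq (div-* {0} (div-* (int-signed m) (ℕ-integral (m !))) d))
    where
    eq : signed m * f * (ρ (ℤ.- (+ 1)) * x) ≡ poch ½ m * x
    eq = trans (solve 4 (λ s f a x → s :* f :* (a :* x) := s :* (f :* a) :* x) refl (signed m) f (ρ (ℤ.- (+ 1))) x)
      (cong (_* x) (trans (cong (signed m *_) (sym (R≡fρ (ℤ.- (+ 1))))) (sym poch-½-R)))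
    int-signed : ∀ n → Integral (signed n)
    int-signed zero    = ℕ-integral 1
    int-signed (suc n) = div-neg (int-signed n)

  -- Multiplied by m!³, this is the numerator minus the denominator of the ratio that accompanies
  -- 3p² in the term n = m.
  defect : ℚ
  defect = ρ (ℤ.- (+ 1)) * ρ (+ 1) * ρ (ℤ.- (+ 3)) - w ³

  -- 6 (ρ(−1)⁴ ρ(1) ρ(−3) − ρ(−2)³) and ρ(2) ρ(−4) ρ(−1) − ρ(−2)² ρ(1) have the same expansion modulo p³,
  -- and the latter is zero by the duplication formula.
  div-3defect : Divides 3 (ℕ→ℚ 3 * defect)
  -- The 6 is split as 2 · 3, and only 2 is cancelled, because p may be 3.
  div-3defect = cancel-ρ₋₁ (cancel-ρ₋₁ (cancel-ρ₋₁ (div-cancel 2 p∤2 (subst (Divides 3) eq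
    (div-- (div-* {0} {3} (ℕ-integral 6) (div-- (error (A ∙ A ∙ A ∙ A ∙ B ∙ C)) (error (D ∙ D ∙ D))))
           (div-- (error (jet-ρ (+ 2) ∙ jet-ρ (ℤ.- (+ 4)) ∙ A)) (error (D ∙ D ∙ B))))))))
    where
    a = ρ (ℤ.- (+ 1))
    b = ρ (+ 1)
    c = ρ (ℤ.- (+ 3))
    d = ρ (ℤ.- (+ 2))
    infixl 7 _∙_
    _∙_ : ∀ {x y s t r s′ t′ r′} → HasJet x s t r → HasJet y s′ t′ r′ →
          HasJet (x * y) (s ℤ.+ s′) (t ℤ.+ t′) (r ℤ.+ r′ ℤ.+ s ℤ.* s′)
    _∙_ = jet-*
    A = jet-ρ (ℤ.- (+ 1))
    B = jet-ρ (+ 1)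
    C = jet-ρ (ℤ.- (+ 3))
    D = jet-ρ (ℤ.- (+ 2))
    V = value
    -- The first two jets differ by (2η₂ - η₁²) q², the last two by (12η₂ - 6η₁²) q², whence the
    -- factor 6. Here η₁² - 2η₂ is the sum 1 + 1/2² + ⋯ + 1/m².
    jets-cancel : ∀ x → ℕ→ℚ 6 * ((a * a * a * a * b * c - V (ℤ.- (+ 6)) (+ 14) (+ 11)) - (d * d * d - V (ℤ.- (+ 6)) (+ 12) (+ 12)))
      - ((x * a - V (ℤ.- (+ 3)) (+ 21) (ℤ.- (+ 6))) - (d * d * b - V (ℤ.- (+ 3)) (+ 9) (+ 0)))
      ≡ ℕ→ℚ 6 * (a * a * a * a * b * c - d * d * d) - (x * a - d * d * b)
    jets-cancel x = solve 7 (λ y u z v e₁ e₂ q →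
      let val = λ s t r → con (+ 1) :+ con s :* e₁ :* q :+ (con t :* e₂ :+ con r :* (e₁ :* e₁)) :* (q :* q) in
      con (+ 6) :* ((y :- val (ℤ.- (+ 6)) (+ 14) (+ 11)) :- (u :- val (ℤ.- (+ 6)) (+ 12) (+ 12)))
      :- ((z :- val (ℤ.- (+ 3)) (+ 21) (ℤ.- (+ 6))) :- (v :- val (ℤ.- (+ 3)) (+ 9) (+ 0)))
      := con (+ 6) :* (y :- u) :- (z :- v)) refl
      (a * a * a * a * b * c) (d * d * d) (x * a) (d * d * b) η₁ η₂ q
    eq : ℕ→ℚ 6 * ((a * a * a * a * b * c - V (ℤ.- (+ 6)) (+ 14) (+ 11)) - (d * d * d - V (ℤ.- (+ 6)) (+ 12) (+ 12)))
      - ((ρ (+ 2) * ρ (ℤ.- (+ 4)) * a - V (ℤ.- (+ 3)) (+ 21) (ℤ.- (+ 6))) - (d * d * b - V (ℤ.- (+ 3)) (+ 9) (+ 0)))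
      ≡ ℕ→ℚ 2 * (a * (a * (a * (ℕ→ℚ 3 * defect))))
    eq = begin
      _ ≡⟨ jets-cancel (ρ (+ 2) * ρ (ℤ.- (+ 4))) ⟩
      ℕ→ℚ 6 * (a * a * a * a * b * c - d * d * d) - (ρ (+ 2) * ρ (ℤ.- (+ 4)) * a - d * d * b)
        ≡⟨ cong (λ x → ℕ→ℚ 6 * (a * a * a * a * b * c - d * d * d) - (x * a - d * d * b)) (ρ-duplication (+ 1)) ⟩
      ℕ→ℚ 6 * (a * a * a * a * b * c - d * d * d) - (w * (d * b) * a - d * d * b)
        ≡⟨ cong (λ d → ℕ→ℚ 6 * (a * a * a * a * b * c - d * d * d) - (w * (d * b) * a - d * d * b)) ρ₋₂ ⟩
      ℕ→ℚ 6 * (a * a * a * a * b * c - w * a * (w * a) * (w * a)) - (w * (w * a * b) * a - w * a * (w * a) * b)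
        -- With ρ(-2) = w ρ(-1) inserted, the second difference is zero, and the first is ρ(-1)³
        -- times `defect`.
        ≡⟨ solve 4 (λ a b c w →
             con (+ 6) :* (a :* a :* a :* a :* b :* c :- w :* a :* (w :* a) :* (w :* a)) :- (w :* (w :* a :* b) :* a :- w :* a :* (w :* a) :* b)
             := con (+ 2) :* (a :* (a :* (a :* (con (+ 3) :* (a :* b :* c :- w :* w :* w)))))) refl a b c w ⟩
      ℕ→ℚ 2 * (a * (a * (a * (ℕ→ℚ 3 * defect)))) ∎

  -- The term n = m and the congruence

  u : ℚ
  u = poch ½ m

  -- The factor of index m is q = p/2. The m factors before it give R(-1) by reflection, the next m
  -- are R(1), and the last m give R(-3) by reflection; the two signs cancel.
  poch-3m+1 : poch ½ (suc (2 ℕ.* m ℕ.+ m)) ≡ q * (R (ℤ.- (+ 1)) * R (+ 1) * R (ℤ.- (+ 3)))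
  poch-3m+1 = begin
    poch ½ (suc (2 ℕ.* m ℕ.+ m))
      ≡⟨ cong (poch ½) (ℕₛ.solve 1 (λ m → ℕₛ.con 1 ℕₛ.:+ (ℕₛ.con 2 ℕₛ.:* m ℕₛ.:+ m) ℕₛ.:= m ℕₛ.:+ (ℕₛ.con 1 ℕₛ.:+ (m ℕₛ.:+ m))) refl m) ⟩
    poch ½ (m ℕ.+ suc (m ℕ.+ m))
      ≡⟨ poch-+ ½ m (suc (m ℕ.+ m)) ⟩
    u * poch q (suc (m ℕ.+ m))
      ≡⟨ cong (u *_) (trans (poch-suc q (m ℕ.+ m)) (cong (q *_) (poch-+ (q + 1ℚ) m m))) ⟩
    u * (q * (poch (q + 1ℚ) m * poch (q + 1ℚ + ℕ→ℚ m) m))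
      ≡⟨ cong₂ (λ x y → u * (q * (poch x m * y))) eq₁ (trans (poch-reflect (q + 1ℚ + ℕ→ℚ m) m) (cong (λ x → signed m * poch x m) eq₂)) ⟩
    u * (q * (R (+ 1) * (signed m * R (ℤ.- (+ 3)))))
      ≡⟨ cong (_* (q * (R (+ 1) * (signed m * R (ℤ.- (+ 3)))))) poch-½-R ⟩
    signed m * R (ℤ.- (+ 1)) * (q * (R (+ 1) * (signed m * R (ℤ.- (+ 3)))))
      ≡⟨ solve 5 (λ s q a b c → s :* a :* (q :* (b :* (s :* c))) := (s :* s) :* (q :* (a :* b :* c))) refl (signed m) q (R (ℤ.- (+ 1))) (R (+ 1)) (R (ℤ.- (+ 3))) ⟩
    signed m * signed m * (q * (R (ℤ.- (+ 1)) * R (+ 1) * R (ℤ.- (+ 3))))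
      ≡⟨ trans (cong (_* (q * (R (ℤ.- (+ 1)) * R (+ 1) * R (ℤ.- (+ 3))))) (signed² m)) (ℚₚ.*-identityˡ _) ⟩
    q * (R (ℤ.- (+ 1)) * R (+ 1) * R (ℤ.- (+ 3))) ∎
    where
    eq₁ : q + 1ℚ ≡ 1ℚ + ℤ→ℚ (+ 1) * q
    eq₁ = solve 1 (λ q → q :+ con (+ 1) := con (+ 1) :+ con (+ 1) :* q) refl q
    eq₂ : 1ℚ - (q + 1ℚ + ℕ→ℚ m) - ℕ→ℚ m ≡ 1ℚ + ℤ→ℚ (ℤ.- (+ 3)) * q
    eq₂ = solve 2 (λ h m → let one = h :+ h ; q = h :+ m in
      one :- (q :+ one :+ m) :- m := one :+ con (ℤ.- (+ 3)) :* q) refl ½ (ℕ→ℚ m)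

  w³ : ℕ→ℚ (64 ℕ.^ m) ≡ w ³
  w³ = begin
    ℕ→ℚ (64 ℕ.^ m)                            ≡⟨ cong ℕ→ℚ (trans (ℕₚ.^-*-assoc 4 3 m) (trans (cong (4 ℕ.^_) (ℕₚ.*-comm 3 m)) (sym (ℕₚ.^-*-assoc 4 m 3)))) ⟩
    ℕ→ℚ (v ℕ.^ 3)                             ≡⟨ cong ℕ→ℚ (ℕₛ.solve 1 (λ v → v ℕₛ.:^ 3 ℕₛ.:= v ℕₛ.:* v ℕₛ.:* v) refl v) ⟩
    ℕ→ℚ (v ℕ.* v ℕ.* v)                       ≡⟨ trans (ℕ→ℚ-* (v ℕ.* v) v) (cong (_* w) (ℕ→ℚ-* v v)) ⟩
    w ³                                       ∎
    where v = 4 ℕ.^ m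

  -- At n = j = m the quadratic factor is 36m² + 24m + 3 = 12 (m + ½)(3m + ½). Its factor 3m + ½
  -- lengthens the symbol of length 3m to 3m + 1, which contributes a second q, and 12q² = 3p². The
  -- square of `falling` reduces m!⁵ to m!³.
  G-mm : G m m * (f ³ * w ³) ≡ u ³ * (ℕ→ℚ 12 * q ² * (R (ℤ.- (+ 1)) * R (+ 1) * R (ℤ.- (+ 3))))
  G-mm = begin
    u ³ * b * falling x m ² * i * linear ½ x x * (f ³ * w ³)
      ≡⟨ cong₂ (λ φ ω → u ³ * b * φ ² * i * linear ½ x x * (f ³ * ω)) (falling-! m) (sym w³) ⟩
    u ³ * b * f ² * i * linear ½ x x * (f ³ * ℕ→ℚ (64 ℕ.^ m))
      ≡⟨ solve 7 (λ u b f i x h ω → let cube = λ x → x :* x :* x in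
           cube u :* b :* (f :* f) :* i :* (con (+ 120) :* x :* x :- con (+ 84) :* x :* x :+ con (+ 68) :* h :* x :- con (+ 20) :* h :* x :+ con (+ 12) :* h :* h) :* (cube f :* ω)
           := cube u :* (con (+ 12) :* (h :+ x) :* (b :* (h :+ (x :+ x :+ x)))) :* ((f :* f :* f :* f :* f) :* ω :* i)) refl u b f i x ½ (ℕ→ℚ (64 ℕ.^ m)) ⟩
    u ³ * (ℕ→ℚ 12 * q * (b * (½ + (x + x + x)))) * (f ⁵ * ℕ→ℚ (64 ℕ.^ m) * i)
      ≡⟨ cong₂ (λ y z → u ³ * (ℕ→ℚ 12 * q * (b * (½ + y))) * z) (sym (ℕ→ℚ-2n+j m m)) (den-invDen m) ⟩
    u ³ * (ℕ→ℚ 12 * q * poch ½ (suc (2 ℕ.* m ℕ.+ m))) * 1ℚ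
      ≡⟨ trans (ℚₚ.*-identityʳ _) (cong (λ y → u ³ * (ℕ→ℚ 12 * q * y)) poch-3m+1) ⟩
    u ³ * (ℕ→ℚ 12 * q * (q * r))
      ≡⟨ solve 3 (λ c q r → c :* (con (+ 12) :* q :* (q :* r)) := c :* (con (+ 12) :* (q :* q) :* r)) refl (u ³) q r ⟩
    u ³ * (ℕ→ℚ 12 * q ² * r) ∎
    where
    x = ℕ→ℚ m
    b = poch ½ (2 ℕ.* m ℕ.+ m)
    i = invDen m
    r = R (ℤ.- (+ 1)) * R (+ 1) * R (ℤ.- (+ 3))

  cancel³ : ∀ {k x} y → (∀ {z} → Divides k (y * z) → Divides k z) → Divides k (y ³ * x) → Divides k x
  cancel³ {k} {x} y cancel d = cancel (cancel (cancel (subst (Divides k)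
    (solve 2 (λ y x → y :* y :* y :* x := y :* (y :* (y :* x))) refl y x) d)))

  -- Instead of dividing, the difference is multiplied by the cubes of `u`, `f` and `w`, all of them
  -- units at p, which are cancelled at the end.
  congruence : Divides 5 (S - ℕ→ℚ (3 ℕ.* p ℕ.* p))
  congruence = cancel³ u (cancel-poch m ℕₚ.≤-refl)
    (cancel³ f (div-cancel (m !) {{m !≢0}} (p∤m!))
    (cancel³ w (div-cancel (4 ℕ.^ m) {{m^n≢0 4 m}} (p∤^ (p∤-* p∤2 p∤2) m))
    -- Two multiples of p⁵ are added: one from `S≡G`, and one where 4q² supplies p² and 3 times
    -- `defect` supplies p³.
    (subst (Divides 5) eq (div-+ (div-* {5} {0} S≡G int-fw) (div-* {0} {5} int-u (div-* {2} {3} (div-* (div-* {0} {1} (ℕ-integral 4) div-q) div-q) (div-* {0} {3} int-f³ div-3defect)))))))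
    where
    int-w = ℕ-integral (4 ℕ.^ m)
    int-f = ℕ-integral (m !)
    int-f³ : Integral (f ³)
    int-f³ = div-* (div-* int-f int-f) int-f
    int-fw : Integral (f ³ * w ³)
    int-fw = div-* int-f³ (div-* (div-* int-w int-w) int-w)
    int-u : Integral (u ³)
    int-u = div-* (div-* int-h int-h) int-h
      where int-h = int-poch int-½ m
    r = R (ℤ.- (+ 1)) * R (+ 1) * R (ℤ.- (+ 3))
    unnormalise : f ³ * (ℕ→ℚ 3 * defect) ≡ ℕ→ℚ 3 * (r - f ³ * w ³)
    unnormalise = begin
      f ³ * (ℕ→ℚ 3 * defect)
        ≡⟨ solve 5 (λ f a b c v → f :* f :* f :* (con (+ 3) :* (a :* b :* c :- v)) := con (+ 3) :* ((f :* a) :* (f :* b) :* (f :* c) :- f :* f :* f :* v)) refl f (ρ (ℤ.- (+ 1))) (ρ (+ 1)) (ρ (ℤ.- (+ 3))) (w ³) ⟩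
      ℕ→ℚ 3 * (f * ρ (ℤ.- (+ 1)) * (f * ρ (+ 1)) * (f * ρ (ℤ.- (+ 3))) - f ³ * w ³)
        ≡⟨ cong (λ z → ℕ→ℚ 3 * (z - f ³ * w ³)) (sym (cong₂ _*_ (cong₂ _*_ (R≡fρ (ℤ.- (+ 1))) (R≡fρ (+ 1))) (R≡fρ (ℤ.- (+ 3))))) ⟩
      ℕ→ℚ 3 * (r - f ³ * w ³) ∎
    3p² : ℕ→ℚ (3 ℕ.* p ℕ.* p) ≡ ℕ→ℚ 3 * (q + q) * (q + q)
    3p² = trans (trans (ℕ→ℚ-* (3 ℕ.* p) p) (cong (_* ℕ→ℚ p) (ℕ→ℚ-* 3 p))) (cong (λ x → ℕ→ℚ 3 * x * x) (sym q+q))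
    eq : (u ³ * S - G m m) * (f ³ * w ³) + u ³ * (ℕ→ℚ 4 * q * q * (f ³ * (ℕ→ℚ 3 * defect)))
         ≡ w ³ * (f ³ * (u ³ * (S - ℕ→ℚ (3 ℕ.* p ℕ.* p))))
    eq = begin
      (u ³ * S - G m m) * (f ³ * w ³) + u ³ * (ℕ→ℚ 4 * q * q * (f ³ * (ℕ→ℚ 3 * defect)))
        ≡⟨ cong (λ z → (u ³ * S - G m m) * (f ³ * w ³) + u ³ * (ℕ→ℚ 4 * q * q * z)) unnormalise ⟩
      (u ³ * S - G m m) * (f ³ * w ³) + u ³ * (ℕ→ℚ 4 * q * q * (ℕ→ℚ 3 * (r - f ³ * w ³)))
        ≡⟨ solve 7 (λ u s g f w q r → (u :* s :- g) :* (f :* w) :+ u :* (con (+ 4) :* q :* q :* (con (+ 3) :* (r :- f :* w)))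
             := u :* s :* f :* w :- g :* (f :* w) :+ u :* (con (+ 12) :* (q :* q) :* r) :- u :* con (+ 12) :* (q :* q) :* (f :* w)) refl
             (u ³) S (G m m) (f ³) (w ³) q r ⟩
      u ³ * S * f ³ * w ³ - G m m * (f ³ * w ³) + u ³ * (ℕ→ℚ 12 * q ² * r) - u ³ * ℕ→ℚ 12 * q ² * (f ³ * w ³)
        ≡⟨ cong (λ z → u ³ * S * f ³ * w ³ - z + u ³ * (ℕ→ℚ 12 * q ² * r) - u ³ * ℕ→ℚ 12 * q ² * (f ³ * w ³)) G-mm ⟩
      u ³ * S * f ³ * w ³ - u ³ * (ℕ→ℚ 12 * q ² * r) + u ³ * (ℕ→ℚ 12 * q ² * r) - u ³ * ℕ→ℚ 12 * q ² * (f ³ * w ³)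
        ≡⟨ solve 6 (λ u s f w q r → u :* s :* f :* w :- u :* (con (+ 12) :* (q :* q) :* r) :+ u :* (con (+ 12) :* (q :* q) :* r) :- u :* con (+ 12) :* (q :* q) :* (f :* w)
             := w :* (f :* (u :* (s :- con (+ 3) :* (q :+ q) :* (q :+ q))))) refl (u ³) S (f ³) (w ³) q r ⟩
      w ³ * (f ³ * (u ³ * (S - ℕ→ℚ 3 * (q + q) * (q + q))))
        ≡⟨ cong (λ z → w ³ * (f ³ * (u ³ * (S - z)))) (sym 3p²) ⟩
      w ³ * (f ³ * (u ³ * (S - ℕ→ℚ (3 ℕ.* p ℕ.* p)))) ∎

  congruence-term : CongModPow p 5 (sumTo p term) (ℕ→ℚ (3 ℕ.* p ℕ.* p))
  congruence-term = quotient , quotient-integral ,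
    trans (cong (_- ℕ→ℚ (3 ℕ.* p ℕ.* p)) (sumTo-cong term-G p)) factorisation
    where open Divides congruence

-- Writing p as 2m + 1

odd-prime : ∀ {p} → Prime p → p > 2 → Σ ℕ λ m → m > 0 × p ≡ suc (m ℕ.+ m)
odd-prime {p} pr p>2 with p ℕ.% 2 in r | m≡m%n+[m/n]*n p 2 | m%n<n p 2
... | 0 | eq | _ = ⊥-elim (even (prime⇒irreducible pr (ℕ∣.m%n≡0⇒n∣m p 2 r)))
  where
  even : ¬ (2 ≡ 1 ⊎ 2 ≡ p)
  even (inj₂ refl) = ℕₚ.<-irrefl refl p>2
... | 1 | eq | _ = p ℕ./ 2 , ℕ.>-nonZero⁻¹ _ {{ℕ.≢-nonZero half≢0}} , trans eq (cong suc double)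
  where
  double : p ℕ./ 2 ℕ.* 2 ≡ p ℕ./ 2 ℕ.+ p ℕ./ 2
  double = trans (ℕₚ.*-comm (p ℕ./ 2) 2) (cong (p ℕ./ 2 ℕ.+_) (ℕₚ.+-identityʳ _))
  half≢0 : p ℕ./ 2 ≢ 0
  half≢0 h = ℕₚ.<⇒≱ p>2 (ℕₚ.≤-trans (ℕₚ.≤-reflexive (trans eq (cong (λ x → suc (x ℕ.* 2)) h))) (ℕ.s≤s ℕ.z≤n))
... | suc (suc _) | _ | ℕ.s≤s (ℕ.s≤s ())

theorem2 : (p : ℕ) → Prime p → p > 2 →
    CongModPow p 5 (sumTo p term) (ℕ→ℚ (3 Data.Nat.* p Data.Nat.* p))
theorem2 p pr p>2 = from-half (odd-prime pr p>2) pr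
  where
  -- Here p is generalised again, so that matching on the equation can replace it by 2m + 1.
  from-half : ∀ {p} → (Σ ℕ λ m → m > 0 × p ≡ suc (m ℕ.+ m)) → Prime p →
              CongModPow p 5 (sumTo p term) (ℕ→ℚ (3 ℕ.* p ℕ.* p))
  from-half (m , m>0 , refl) pr = Odd.congruence-term m m>0 pr
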